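{- Let $n=2^s$ with $s\geq 2$, and let $h(z)=\sum_{0\leq i\leq n-1}a_iz^i\in\mathbb{F}_2[z]/(z^n-1)$ with $a_0=1$. Then $h(z)=g(z)g^*(z)$ for some $g(z)=\sum_{0\leq i\leq n-1}b_iz^i\in\mathbb{F}_2[z]/(z^n-1)$ if and only if $h(z)\in H$, where $H$ is the set of all $\sum_{0\leq i\leq n-1}a_iz^i\in\mathbb{F}_2[z]/(z^n-1)$ such that $$\sum_{0\leq i\leq n/2-1,\ i\text{ odd}}a_i=0,\qquad a_0=1,\quad a_{n/2}=0,\qquad a_i=a_{n-i}\ \text{for all } 1\leq i\leq n/2-1.$$ Furthermore, every $h(z)\in H$ has a unique factorization $h(z)=g(z)g^*(z)$ with $g(z)\in G$ (that is, there is exactly one such $g(z)\in G$), where $G$ is the set of all $\sum_{0\leq i\leq n-1}b_iz^i\in\mathbb{F}_2[z]/(z^n-1)$ such that $$b_0=1,\quad b_{n-1}=0,\qquad b_2=b_{n-3}=0,\qquad b_i=b_{n-1-i}\ \text{for all } 1\leq i\leq n/2-1 \text{ with } i\neq 2.$$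
   Context: Elements of $\mathbb{F}_2[z]/(z^n-1)$ are represented by their unique representatives of degree at most $n-1$, and products and equalities are in this ring. For $g(z)=\sum_{0\leq i\leq n-1}b_iz^i\in\mathbb{F}_2[z]/(z^n-1)$, the reciprocal polynomial is $g^*(z)=\sum_{0\leq i\leq n-1}b_iz^{n-i}\pmod{z^n-1}$. -}

module Defs where

open import Algebra.Bundles using (CommutativeRing)
open import Data.Bool.Base using (if_then_else_)
open import Data.Bool.Properties using (xor-∧-commutativeRing)
open import Data.Fin.Base using (Fin; toℕ)
open import Data.Fin.Properties using (nonZeroIndex)
open import Data.Nat.Base as ℕ using (ℕ; zero; suc; _∸_; _≤_)
open import Data.Nat.DivMod using (_/_; _%_)
open import Data.Nat.Properties using (_≟_)
open import Data.Vec.Base using (Vec; []; _∷_; lookup; tabulate)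
open import Relation.Binary.PropositionalEquality using (_≡_; _≢_)
open import Relation.Nullary.Decidable using (does)

open CommutativeRing xor-∧-commutativeRing public
  using (0#; 1#; _+_; _*_)
  renaming (Carrier to 𝔽₂)

open import Algebra.Properties.Semiring.Sum
  (CommutativeRing.semiring xor-∧-commutativeRing) public
  using (sum-syntax)

-- An element of 𝔽₂[z]/(zⁿ - 1) is the vector of coefficients
-- (b₀ , … , bₙ₋₁) of its representative of degree at most n - 1, so
-- equality in the ring is propositional equality of vectors.
R : ℕ → Set
R n = Vec 𝔽₂ n

-- Total in the exponent: the representative has coefficient 0 at every
-- exponent ≥ n.
coeff : ∀ {n} → R n → ℕ → 𝔽₂
coeff []       _       = 0#
coeff (b ∷ bs) zero    = b
coeff (b ∷ bs) (suc i) = coeff bs i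

-- The class of the monomial zᵐ; its representative is z to the power m mod n.
infix 9 z^_
z^_ : ∀ {n} → ℕ → R n
z^_ {n} m = tabulate λ k →
  if does (toℕ k ≟ (m % n) ⦃ nonZeroIndex k ⦄) then 1# else 0#

-- (Σᵢ bᵢ zⁱ) (Σⱼ cⱼ zʲ) = Σᵢ Σⱼ bᵢ cⱼ z^(i+j), coefficient by coefficient.
infixl 7 _·_
_·_ : ∀ {n} → R n → R n → R n
_·_ {n} g h = tabulate λ k →
  ∑[ i < n ] (∑[ j < n ]
    ((lookup g i * lookup h j) * lookup (z^ (toℕ i ℕ.+ toℕ j)) k))

-- Σᵢ bᵢ z^(n-i), coefficient by coefficient; the term i = 0 reduces to b₀ z^0.
infix 8 _⋆
_⋆ : ∀ {n} → R n → R n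
_⋆ {n} g = tabulate λ k →
  ∑[ i < n ] (lookup g i * lookup (z^ (n ∸ toℕ i)) k)

record H {n : ℕ} (h : R n) : Set where
  field
    odd-sum   : ∑[ i < n / 2 ] (if does (toℕ i % 2 ≟ 1)
                                then coeff h (toℕ i) else 0#) ≡ 0#
    constant  : coeff h 0 ≡ 1#
    middle    : coeff h (n / 2) ≡ 0#
    symmetric : ∀ i → 1 ≤ i → i ≤ n / 2 ∸ 1 → coeff h i ≡ coeff h (n ∸ i)

record G {n : ℕ} (g : R n) : Set where
  field
    constant   : coeff g 0 ≡ 1#
    last       : coeff g (n ∸ 1) ≡ 0#
    second     : coeff g 2 ≡ 0#
    third-last : coeff g (n ∸ 3) ≡ 0#
    symmetric  : ∀ i → 1 ≤ i → i ≤ n / 2 ∸ 1 → i ≢ 2 →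
                 coeff g i ≡ coeff g (n ∸ 1 ∸ i)

{-# OPTIONS --safe #-}
module Submission where

-- Indices are read modulo n = 2m = 4q.  The coefficients of g · g ⋆ are the
-- autocorrelations A(k) = Σᵢ bᵢ bₖ₊ᵢ.  Since A(-k) = A(k), A(m) = 0, and the
-- sum of A over odd k < m is (Σ b₂ᵢ)(Σ b₂ᵢ₊₁) while A(0) = Σ b₂ᵢ + Σ b₂ᵢ₊₁,
-- the condition A(0) = 1 forces h ∈ H.
--
-- Conversely g ∈ G means g = 1 + p with pᵢ = p₋₁₋ᵢ and p₀ = p₂ = 0.  Then
-- p ⋆ = z p, so g · g ⋆ = 1 + (1 + z) p + z p² is, up to the constant 1, linear
-- in p over 𝔽₂.  An element r of the kernel satisfies r₂ₗ₊₂ = r₂ₗ₊₁ and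
-- r₂ₗ₊₁ + r₂ₗ = rₗ + rₗ₊ₘ, and wⱼ = r₂ⱼ then vanishes by induction on the
-- 2-adic valuation of j; this gives uniqueness.  Existence follows by counting:
-- the coefficients p₀, p₂, A(2), … , A(m-1) define an injective, hence
-- surjective, self-map of 𝔽₂ᵐ, and these values of A determine h ∈ H.

open import Defs
open import Algebra.Bundles using (CommutativeRing)
open import Data.Bool.Base using (true; false; if_then_else_)
open import Data.Bool.Properties using (xor-∧-commutativeRing; xor-same; ∧-idem)
open import Data.Bool.Solver using (module xor-∧-Solver)
open import Data.Fin.Base as Fin using (Fin; toℕ; fromℕ<; funToFin; finToFun; combine)
open import Data.Fin.Properties as Finₚ
  using (toℕ-fromℕ<; any?; pigeonhole; 2↔Bool; finToFun-funToFin; funToFin-finToFin)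
open import Data.Nat.Base as ℕ
  using (ℕ; zero; suc; _∸_; _≤_; _<_; _^_; NonZero; z≤n; s≤s; z<s; s<s; s<s⁻¹)
open import Data.Nat.DivMod
  using (_/_; _%_; m<n⇒m%n≡m; m%n<n; m%n%n≡m%n; %-distribˡ-+; [m+n]%n≡m%n; [m+kn]%n≡m%n; m*n/n≡m; m≡m%n+[m/n]*n)
open import Data.Nat.Divisibility
  using (_∣_; divides; _∣?_; ∣m∣n⇒∣m+n; ∣m+n∣m⇒∣n; ∣-refl; ∣-reflexive; n∣m*n)
import Data.Nat.Properties as ℕₚ
open ℕₚ using (_≟_)
open import Data.Nat.Tactic.RingSolver using (solve-∀)
open import Data.Product using (_×_; _,_; ∃; ∃!; map₂)
open import Data.Sum.Base using (_⊎_; inj₁; inj₂)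
open import Data.Vec.Base using (lookup; tabulate; []; _∷_)
open import Data.Vec.Properties using (lookup∘tabulate; tabulate∘lookup; tabulate-cong)
open import Function.Base using (_∘_)
open import Function.Bundles using (_⇔_; mk⇔; Inverse)
open import Relation.Binary.Definitions using (tri<; tri≈; tri>)
open import Relation.Binary.PropositionalEquality
  using (_≡_; refl; sym; trans; cong; cong₂; subst; module ≡-Reasoning)
open import Relation.Nullary.Decidable using (does; yes; no; does-⇔)
open import Relation.Nullary.Negation using (¬_; contradiction)
open import Relation.Unary using (_∈_)

open import Algebra.Properties.Semiring.Sum (CommutativeRing.semiring xor-∧-commutativeRing)
  using (sum-cong-≗; ∑-distrib-+; *-distribˡ-sum)
open xor-∧-Solver using (solve; _:+_; _:*_; _:=_)
open CommutativeRing xor-∧-commutativeRing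
  using (+-identityʳ; +-comm; +-assoc; *-comm; *-identityʳ; zeroʳ)
open ≡-Reasoning

private
  variable
    n k l : ℕ
    f g : ℕ → 𝔽₂

-- Finite sums over 𝔽₂ indexed by natural numbers

+-cancel : ∀ x {y z : 𝔽₂} → x + y ≡ z + x → y ≡ z
+-cancel x {y} {z} eq = begin
  y             ≡⟨ solve 2 (λ x y → y := x :+ (x :+ y)) refl x y ⟩
  x + (x + y)   ≡⟨ cong (x +_) eq ⟩
  x + (z + x)   ≡⟨ solve 2 (λ x z → x :+ (z :+ x) := z) refl x z ⟩
  z             ∎

-- Indexing by natural numbers instead of `Fin n` lets indices be doubled, reflected and shifted
-- past the end of the range without conversions; `∑<≡∑` leads back to the sums of the definitions.
∑< : ℕ → (ℕ → 𝔽₂) → 𝔽₂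
∑< zero    f = 0#
∑< (suc n) f = f 0 + ∑< n (f ∘ suc)

∑<≡∑ : ∀ n f → ∑< n f ≡ ∑[ i < n ] f (toℕ i)
∑<≡∑ zero    f = refl
∑<≡∑ (suc n) f = cong (f 0 +_) (∑<≡∑ n (f ∘ suc))

∑<-cong : ∀ n → (∀ i → i < n → f i ≡ g i) → ∑< n f ≡ ∑< n g
∑<-cong zero    eq = refl
∑<-cong (suc n) eq = cong₂ _+_ (eq 0 z<s) (∑<-cong n λ i i<n → eq (suc i) (s<s i<n))

∑<-zero : ∀ n → (∀ i → i < n → f i ≡ 0#) → ∑< n f ≡ 0#
∑<-zero zero    eq = refl
∑<-zero (suc n) eq = cong₂ _+_ (eq 0 z<s) (∑<-zero n λ i i<n → eq (suc i) (s<s i<n))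

∑<-distrib-+ : ∀ n f g → ∑< n (λ i → f i + g i) ≡ ∑< n f + ∑< n g
∑<-distrib-+ n f g = begin
  ∑< n (λ i → f i + g i)                              ≡⟨ ∑<≡∑ n _ ⟩
  ∑[ i < n ] (f (toℕ i) + g (toℕ i))                  ≡⟨ ∑-distrib-+ {n} (f ∘ toℕ) (g ∘ toℕ) ⟩
  (∑[ i < n ] f (toℕ i)) + (∑[ i < n ] g (toℕ i))     ≡⟨ cong₂ _+_ (∑<≡∑ n f) (∑<≡∑ n g) ⟨
  ∑< n f + ∑< n g                                     ∎

*-distribˡ-∑< : ∀ n x f → x * ∑< n f ≡ ∑< n (λ i → x * f i)
*-distribˡ-∑< n x f = begin
  x * ∑< n f                        ≡⟨ cong (x *_) (∑<≡∑ n f) ⟩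
  x * (∑[ i < n ] f (toℕ i))        ≡⟨ *-distribˡ-sum {n} x (f ∘ toℕ) ⟩
  ∑[ i < n ] (x * f (toℕ i))        ≡⟨ ∑<≡∑ n _ ⟨
  ∑< n (λ i → x * f i)              ∎

*-distribʳ-∑< : ∀ n x f → ∑< n f * x ≡ ∑< n (λ i → f i * x)
*-distribʳ-∑< n x f = begin
  ∑< n f * x                ≡⟨ *-comm (∑< n f) x ⟩
  x * ∑< n f                ≡⟨ *-distribˡ-∑< n x f ⟩
  ∑< n (λ i → x * f i)      ≡⟨ ∑<-cong n (λ i _ → *-comm x (f i)) ⟩
  ∑< n (λ i → f i * x)      ∎

∑<-comm : ∀ m n (f : ℕ → ℕ → 𝔽₂) →
  ∑< m (λ i → ∑< n (f i)) ≡ ∑< n (λ j → ∑< m (λ i → f i j))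
∑<-comm zero    n f = sym (∑<-zero n λ _ _ → refl)
∑<-comm (suc m) n f = begin
  ∑< n (f 0) + ∑< m (λ i → ∑< n (f (suc i)))
    ≡⟨ cong (∑< n (f 0) +_) (∑<-comm m n (f ∘ suc)) ⟩
  ∑< n (f 0) + ∑< n (λ j → ∑< m (λ i → f (suc i) j))
    ≡⟨ ∑<-distrib-+ n _ _ ⟨
  ∑< n (λ j → ∑< (suc m) (λ i → f i j))
    ∎

∑<-last : ∀ n f → ∑< (suc n) f ≡ ∑< n f + f n
∑<-last zero    f = +-comm (f 0) 0#
∑<-last (suc n) f = trans (cong (f 0 +_) (∑<-last n (f ∘ suc)))
                          (sym (+-assoc (f 0) (∑< n (f ∘ suc)) (f (suc n))))

∑<-split : ∀ k l f → ∑< (k ℕ.+ l) f ≡ ∑< k f + ∑< l (λ i → f (k ℕ.+ i))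
∑<-split zero    l f = refl
∑<-split (suc k) l f = trans (cong (f 0 +_) (∑<-split k l (f ∘ suc)))
                             (sym (+-assoc (f 0) (∑< k (f ∘ suc)) _))

∑<-pairs : ∀ k f → ∑< (k ℕ.+ k) f ≡ ∑< k (λ i → f (i ℕ.+ i)) + ∑< k (λ i → f (suc (i ℕ.+ i)))
∑<-pairs zero    f = refl
∑<-pairs (suc k) f rewrite ℕₚ.+-suc k k = begin
  f 0 + (f 1 + ∑< (k ℕ.+ k) (f ∘ suc ∘ suc))
    ≡⟨ cong (λ x → f 0 + (f 1 + x)) (∑<-pairs k (f ∘ suc ∘ suc)) ⟩
  f 0 + (f 1 + (∑< k (λ i → f (2 ℕ.+ (i ℕ.+ i))) + ∑< k (λ i → f (3 ℕ.+ (i ℕ.+ i)))))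
    ≡⟨ solve 4 (λ a b c d → a :+ (b :+ (c :+ d)) := (a :+ c) :+ (b :+ d)) refl (f 0) (f 1) _ _ ⟩
  (f 0 + ∑< k (λ i → f (2 ℕ.+ (i ℕ.+ i)))) + (f 1 + ∑< k (λ i → f (3 ℕ.+ (i ℕ.+ i))))
    ≡⟨ cong₂ (λ x y → (f 0 + x) + (f 1 + y))
         (∑<-cong k λ i _ → cong (f ∘ suc) (sym (ℕₚ.+-suc i i)))
         (∑<-cong k λ i _ → cong (f ∘ suc ∘ suc) (sym (ℕₚ.+-suc i i))) ⟩
  _ ∎

-- The reflection of the index is given as a relation between `i` and `j`, free of truncated
-- subtraction; a caller can match on its proof to eliminate `n`.
∑<-reverse : ∀ n → (∀ i j → suc (i ℕ.+ j) ≡ n → f i ≡ g j) → ∑< n f ≡ ∑< n g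
∑<-reverse         zero    eq = refl
∑<-reverse {f} {g} (suc n) eq = begin
  f 0 + ∑< n (f ∘ suc)  ≡⟨ cong₂ _+_ (eq 0 n refl)
                             (∑<-reverse n λ i j i+j → eq (suc i) j (cong suc i+j)) ⟩
  g n + ∑< n g          ≡⟨ +-comm (g n) (∑< n g) ⟩
  ∑< n g + g n          ≡⟨ ∑<-last n g ⟨
  ∑< (suc n) g          ∎

-- Periodic sequences

Periodic : ℕ → (ℕ → 𝔽₂) → Set
Periodic n f = ∀ i → f (n ℕ.+ i) ≡ f i

periodic-∣ : ∀ {d} → Periodic n f → n ∣ d → ∀ i → f (d ℕ.+ i) ≡ f i
periodic-∣ per (divides zero refl) i = refl
periodic-∣ {n} {f} per (divides (suc c) refl) i =
  trans (cong f (ℕₚ.+-assoc n (c ℕ.* n) i))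
        (trans (per _) (periodic-∣ per (divides c refl) i))

periodic-% : ∀ .{{_ : NonZero n}} → Periodic n f → ∀ i → f (i % n) ≡ f i
periodic-% {n} {f} per i = begin
  f (i % n)                          ≡⟨ periodic-∣ per (divides (i / n) refl) (i % n) ⟨
  f ((i / n) ℕ.* n ℕ.+ i % n)        ≡⟨ cong f (ℕₚ.+-comm _ (i % n)) ⟩
  f (i % n ℕ.+ (i / n) ℕ.* n)        ≡⟨ cong f (m≡m%n+[m/n]*n i n) ⟨
  f i                                ∎

-- Advancing the window by one drops the term at 0 and gains the term at `n`, and these agree by
-- periodicity.
∑<-shift : Periodic n f → ∀ k → ∑< n (λ i → f (k ℕ.+ i)) ≡ ∑< n f
∑<-shift         per zero    = refl
∑<-shift {n} {f} per (suc k) = begin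
  ∑< n (λ i → f (suc (k ℕ.+ i)))  ≡⟨ ∑<-shift {f = f ∘ suc} (λ i → trans (cong f (sym (ℕₚ.+-suc n i))) (per (suc i))) k ⟩
  ∑< n (f ∘ suc)                  ≡⟨ +-cancel (f 0) (trans (∑<-last n f) (cong (∑< n f +_) f[n]≡f[0])) ⟩
  ∑< n f                          ∎
  where
  f[n]≡f[0] : f n ≡ f 0
  f[n]≡f[0] = trans (cong f (sym (ℕₚ.+-identityʳ n))) (per 0)

-- `e` serves as -k modulo `n`, so that a sum over a full period can be shifted back by `k`.
complement : ∀ n .{{_ : NonZero n}} k → ∃ λ e → n ∣ k ℕ.+ e
complement (suc n) k = n ℕ.* k , divides k (lemma n k)
  where
  lemma : ∀ n k → k ℕ.+ n ℕ.* k ≡ k ℕ.* suc n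
  lemma = solve-∀

-- Autocorrelations of periodic sequences

autocorrelation : ℕ → (ℕ → 𝔽₂) → ℕ → 𝔽₂
autocorrelation n f k = ∑< n λ i → f i * f (k ℕ.+ i)

shift-periodic : Periodic n f → ∀ k → Periodic n (λ i → f (k ℕ.+ i))
shift-periodic {n} {f} per k i = trans (cong f (lemma k n i)) (per _)
  where
  lemma : ∀ k n i → k ℕ.+ (n ℕ.+ i) ≡ n ℕ.+ (k ℕ.+ i)
  lemma = solve-∀

autocorrelation-summand : Periodic n f → ∀ k → Periodic n (λ i → f i * f (k ℕ.+ i))
autocorrelation-summand per k i = cong₂ _*_ (per i) (shift-periodic per k i)

autocorrelation-periodic : Periodic n f → Periodic n (autocorrelation n f)
autocorrelation-periodic {n} {f} per k = ∑<-cong n λ i _ →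
  cong (f i *_) (trans (cong f (ℕₚ.+-assoc n k i)) (per (k ℕ.+ i)))

-- Here `l` is -k modulo `n`. Shifting the summation index by `l` turns fᵢ fₖ₊ᵢ into fₗ₊ᵢ fₖ₊ₗ₊ᵢ,
-- whose second factor is fᵢ.
autocorrelation-even : Periodic n f → n ∣ k ℕ.+ l → autocorrelation n f k ≡ autocorrelation n f l
autocorrelation-even {n} {f} {k} {l} per n∣k+l = begin
  ∑< n (λ i → f i * f (k ℕ.+ i))
    ≡⟨ ∑<-shift (autocorrelation-summand per k) l ⟨
  ∑< n (λ i → f (l ℕ.+ i) * f (k ℕ.+ (l ℕ.+ i)))
    ≡⟨ ∑<-cong n (λ i _ → trans (*-comm (f (l ℕ.+ i)) _)
         (cong (_* f (l ℕ.+ i)) (trans (cong f (sym (ℕₚ.+-assoc k l i))) (periodic-∣ per n∣k+l i)))) ⟩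
  ∑< n (λ i → f i * f (l ℕ.+ i))
    ∎

-- The terms at i and m + i are the same product with its factors exchanged, so the two halves of
-- the sum cancel.
autocorrelation-middle : ∀ m → Periodic (m ℕ.+ m) f → autocorrelation (m ℕ.+ m) f m ≡ 0#
autocorrelation-middle {f} m per = begin
  ∑< (m ℕ.+ m) (λ i → f i * f (m ℕ.+ i))
    ≡⟨ ∑<-split m m _ ⟩
  S + ∑< m (λ i → f (m ℕ.+ i) * f (m ℕ.+ (m ℕ.+ i)))
    ≡⟨ cong (S +_) (∑<-cong m λ i _ → trans (*-comm (f (m ℕ.+ i)) _)
         (cong (_* f (m ℕ.+ i)) (trans (cong f (sym (ℕₚ.+-assoc m m i))) (per i)))) ⟩
  S + S
    ≡⟨ xor-same S ⟩
  0# ∎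
  where
  S : 𝔽₂
  S = ∑< m (λ i → f i * f (m ℕ.+ i))

sum-1⇒product-0 : ∀ x y → x + y ≡ 1# → x * y ≡ 0#
sum-1⇒product-0 false y     _ = refl
sum-1⇒product-0 true  false _ = refl

-- `X` is the cross-correlation of the even-indexed with the odd-indexed entries. Each A(2t+1) is
-- X(t) + X(-1-t), so the sum over t < q collects every value of `X` once, and the sum of a
-- cross-correlation over a full period is the product of the two sums.
autocorrelation-odd-sum : ∀ q → Periodic ((q ℕ.+ q) ℕ.+ (q ℕ.+ q)) f →
  autocorrelation ((q ℕ.+ q) ℕ.+ (q ℕ.+ q)) f 0 ≡ 1# →
  ∑< q (λ t → autocorrelation ((q ℕ.+ q) ℕ.+ (q ℕ.+ q)) f (suc (t ℕ.+ t))) ≡ 0#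
autocorrelation-odd-sum {f} q per a[0]≡1 = begin
  ∑< q (λ t → A (suc (t ℕ.+ t)))
    ≡⟨ ∑<-cong q (λ t t<q → A-odd t (m′ ∸ suc t) (ℕₚ.m+[n∸m]≡n (ℕₚ.≤-trans t<q (ℕₚ.m≤m+n q q)))) ⟩
  ∑< q (λ t → X t + X (m′ ∸ suc t))
    ≡⟨ ∑<-distrib-+ q X _ ⟩
  ∑< q X + ∑< q (λ t → X (m′ ∸ suc t))
    -- As t runs through 0, ..., q-1, the index m′-1-t runs backwards through the upper half q, ...,
    -- m′-1.
    ≡⟨ cong (∑< q X +_) (∑<-reverse q λ { i j refl → cong X (reflect i j) }) ⟩
  ∑< q X + ∑< q (λ t → X (q ℕ.+ t))
    ≡⟨ ∑<-split q q X ⟨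
  ∑< m′ X
    ≡⟨ ∑<-comm m′ m′ (λ t i → even i * odd (t ℕ.+ i)) ⟩
  ∑< m′ (λ i → ∑< m′ (λ t → even i * odd (t ℕ.+ i)))
    ≡⟨ ∑<-cong m′ (λ i _ → sym (*-distribˡ-∑< m′ (even i) _)) ⟩
  ∑< m′ (λ i → even i * ∑< m′ (λ t → odd (t ℕ.+ i)))
    -- The inner sum covers a full period of `odd`, hence does not depend on `i`, and the double sum
    -- factors.
    ≡⟨ ∑<-cong m′ (λ i _ → cong (even i *_) (trans
         (∑<-cong m′ λ t _ → cong odd (ℕₚ.+-comm t i)) (∑<-shift {m′} odd-periodic i))) ⟩
  ∑< m′ (λ i → even i * ∑< m′ odd)
    ≡⟨ *-distribʳ-∑< m′ (∑< m′ odd) _ ⟨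
  ∑< m′ even * ∑< m′ odd
    ≡⟨ sum-1⇒product-0 (∑< m′ even) (∑< m′ odd) E+O≡1 ⟩
  0# ∎
  where
  m′ n′ : ℕ
  m′ = q ℕ.+ q
  n′ = m′ ℕ.+ m′
  A even odd X : ℕ → 𝔽₂
  A = autocorrelation n′ f
  even i = f (i ℕ.+ i)
  odd i = f (suc (i ℕ.+ i))
  X t = ∑< m′ (λ i → even i * odd (t ℕ.+ i))

  double : ∀ m i → (m ℕ.+ i) ℕ.+ (m ℕ.+ i) ≡ (m ℕ.+ m) ℕ.+ (i ℕ.+ i)
  double = solve-∀

  even-periodic : Periodic m′ even
  even-periodic i = trans (cong f (double m′ i)) (per _)

  odd-periodic : Periodic m′ odd
  odd-periodic i = trans (cong f (trans (cong suc (double m′ i)) (sym (ℕₚ.+-suc n′ _)))) (per _)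

  reflect : ∀ i j → (suc (i ℕ.+ j) ℕ.+ suc (i ℕ.+ j)) ∸ suc i ≡ suc (i ℕ.+ j) ℕ.+ j
  reflect i j = trans (cong (_∸ suc i) (lemma i j)) (ℕₚ.m+n∸m≡n (suc i) _)
    where
    lemma : ∀ i j → suc (i ℕ.+ j) ℕ.+ suc (i ℕ.+ j) ≡ suc i ℕ.+ (suc (i ℕ.+ j) ℕ.+ j)
    lemma = solve-∀

  -- Even summation indices contribute `X t` directly. Odd ones contribute products of odd i and
  -- even (t+1+i), which a shift by t′, that is by -1-t modulo m′, turns into the terms of `X t′`.
  A-odd : ∀ t t′ → suc t ℕ.+ t′ ≡ m′ → A (suc (t ℕ.+ t)) ≡ X t + X t′
  A-odd t t′ t+t′ = begin
    A (suc (t ℕ.+ t))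
      ≡⟨ ∑<-pairs m′ _ ⟩
    ∑< m′ (λ i → even i * f (suc (t ℕ.+ t) ℕ.+ (i ℕ.+ i))) +
    ∑< m′ (λ i → odd i * f (suc (t ℕ.+ t) ℕ.+ suc (i ℕ.+ i)))
      ≡⟨ cong₂ _+_ (∑<-cong m′ λ i _ → cong (λ k → even i * f k) (index₁ t i))
                   (∑<-cong m′ λ i _ → cong (λ k → odd i * f k) (index₂ t i)) ⟩
    X t + ∑< m′ (λ i → odd i * even (suc t ℕ.+ i))
      ≡⟨ cong (X t +_) (∑<-shift {m′} (λ i → cong₂ _*_ (odd-periodic i) (shift-periodic {m′} even-periodic (suc t) i)) t′) ⟨
    X t + ∑< m′ (λ i → odd (t′ ℕ.+ i) * even (suc t ℕ.+ (t′ ℕ.+ i)))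
      ≡⟨ cong (X t +_) (∑<-cong m′ λ i _ → trans (*-comm (odd (t′ ℕ.+ i)) _)
           (cong (_* odd (t′ ℕ.+ i)) (trans
             (cong even (trans (sym (ℕₚ.+-assoc (suc t) t′ i)) (cong (ℕ._+ i) t+t′)))
             (even-periodic i)))) ⟩
    X t + X t′ ∎
    where
    index₁ : ∀ t i → suc (t ℕ.+ t) ℕ.+ (i ℕ.+ i) ≡ suc ((t ℕ.+ i) ℕ.+ (t ℕ.+ i))
    index₁ = solve-∀
    index₂ : ∀ t i → suc (t ℕ.+ t) ℕ.+ suc (i ℕ.+ i) ≡ (suc t ℕ.+ i) ℕ.+ (suc t ℕ.+ i)
    index₂ = solve-∀

  -- Squaring is the identity on 𝔽₂, so A(0) is the plain sum of the sequence.
  E+O≡1 : ∑< m′ even + ∑< m′ odd ≡ 1#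
  E+O≡1 = begin
    ∑< m′ even + ∑< m′ odd  ≡⟨ ∑<-pairs m′ f ⟨
    ∑< n′ f                 ≡⟨ ∑<-cong n′ (λ i _ → sym (∧-idem (f i))) ⟩
    A 0                     ≡⟨ a[0]≡1 ⟩
    1#                      ∎

-- Sequences symmetric under i ↦ -1-i and their autocorrelations

∑<-reflect-odd : ∀ m → (∀ i j → suc (i ℕ.+ j) ≡ m ℕ.+ m → f i ≡ f j) → ∑< (m ℕ.+ m) f ≡ 0#
∑<-reflect-odd {f} m eq = begin
  ∑< (m ℕ.+ m) f                       ≡⟨ ∑<-split m m f ⟩
  ∑< m f + ∑< m (λ i → f (m ℕ.+ i))    ≡⟨ cong (_+ ∑< m (λ i → f (m ℕ.+ i)))
                                            (∑<-reverse m λ { i j refl → eq i (m ℕ.+ j) (lemma i j) }) ⟩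
  ∑< m (λ i → f (m ℕ.+ i)) + ∑< m (λ i → f (m ℕ.+ i))  ≡⟨ xor-same (∑< m (λ i → f (m ℕ.+ i))) ⟩
  0# ∎
  where
  lemma : ∀ i j → suc (i ℕ.+ (suc (i ℕ.+ j) ℕ.+ j)) ≡ suc (i ℕ.+ j) ℕ.+ suc (i ℕ.+ j)
  lemma = solve-∀

-- Modulo 2m the reflection i ↦ -i fixes exactly 0 and m, and all other terms cancel in pairs; the
-- reflection i ↦ -1-i of `∑<-reflect-odd` has no fixed point.
∑<-reflect-even : ∀ m .{{_ : NonZero m}} → (∀ i j → i ℕ.+ j ≡ m ℕ.+ m → f i ≡ f j) →
  ∑< (m ℕ.+ m) f ≡ f 0 + f m
∑<-reflect-even {f} (suc m) eq = begin
  ∑< (suc m ℕ.+ suc m) f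
    ≡⟨ ∑<-split (suc m) (suc m) f ⟩
  (f 0 + ∑< m (f ∘ suc)) + (f (suc m ℕ.+ 0) + ∑< m (λ i → f (suc m ℕ.+ suc i)))
    ≡⟨ cong₂ (λ x y → (f 0 + x) + (f y + S))
         (∑<-reverse m λ { i j refl → eq (suc i) (suc m ℕ.+ suc j) (lemma i j) })
         (ℕₚ.+-identityʳ (suc m)) ⟩
  (f 0 + S) + (f (suc m) + S)
    ≡⟨ solve 3 (λ a b s → (a :+ s) :+ (b :+ s) := a :+ b) refl (f 0) (f (suc m)) S ⟩
  f 0 + f (suc m)
    ∎
  where
  S : 𝔽₂
  S = ∑< m (λ i → f (suc m ℕ.+ suc i))
  lemma : ∀ i j → suc i ℕ.+ (suc (suc (i ℕ.+ j)) ℕ.+ suc j) ≡ suc (suc (i ℕ.+ j)) ℕ.+ suc (suc (i ℕ.+ j))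
  lemma = solve-∀

Symmetric : ℕ → (ℕ → 𝔽₂) → Set
Symmetric n f = ∀ i j → n ∣ suc (i ℕ.+ j) → f i ≡ f j

-- The indices n + i and i have a common mirror image `j`.
symmetric⇒periodic : ∀ .{{_ : NonZero n}} → Symmetric n f → Periodic n f
symmetric⇒periodic {n} sm i with complement n (suc i)
... | j , n∣ = trans (sm (n ℕ.+ i) j (subst (n ∣_) (lemma n i j) (∣m∣n⇒∣m+n ∣-refl n∣))) (sym (sm i j n∣))
  where
  lemma : ∀ n i j → n ℕ.+ (suc i ℕ.+ j) ≡ suc ((n ℕ.+ i) ℕ.+ j)
  lemma = solve-∀

module _ (m : ℕ) .{{_ : NonZero m}} .{{_ : NonZero (m ℕ.+ m)}}
         (f : ℕ → 𝔽₂) (sm : Symmetric (m ℕ.+ m) f) where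

  private
    per : Periodic (m ℕ.+ m) f
    per = symmetric⇒periodic sm

  -- Shifting by `e`, which is -l, makes the summand f(i-l) f(i+l). The reflection i ↦ -1-i
  -- exchanges the two factors and has no fixed point, so everything cancels.
  symmetric-autocorrelation-even : ∀ l → autocorrelation (m ℕ.+ m) f (l ℕ.+ l) ≡ 0#
  symmetric-autocorrelation-even l with complement (m ℕ.+ m) l
  ... | e , n∣l+e = trans
    (sym (∑<-shift (autocorrelation-summand per (l ℕ.+ l)) e))
    (∑<-reflect-odd m λ i j i+j → trans (cong₂ _*_
      (sm _ _ (subst (m ℕ.+ m ∣_) (lemma l e i j) (n∣ i j i+j)))
      (sm _ _ (subst (m ℕ.+ m ∣_) (lemma′ l e i j) (n∣ i j i+j))))
      (*-comm (f (l ℕ.+ l ℕ.+ (e ℕ.+ j))) _))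
    where
    n∣ : ∀ i j → suc (i ℕ.+ j) ≡ m ℕ.+ m → m ℕ.+ m ∣ (l ℕ.+ e) ℕ.+ (l ℕ.+ e) ℕ.+ suc (i ℕ.+ j)
    n∣ i j i+j = ∣m∣n⇒∣m+n (∣m∣n⇒∣m+n n∣l+e n∣l+e) (∣-reflexive (sym i+j))
    lemma : ∀ l e i j → (l ℕ.+ e) ℕ.+ (l ℕ.+ e) ℕ.+ suc (i ℕ.+ j) ≡ suc ((e ℕ.+ i) ℕ.+ (l ℕ.+ l ℕ.+ (e ℕ.+ j)))
    lemma = solve-∀
    lemma′ : ∀ l e i j → (l ℕ.+ e) ℕ.+ (l ℕ.+ e) ℕ.+ suc (i ℕ.+ j) ≡ suc ((l ℕ.+ l ℕ.+ (e ℕ.+ i)) ℕ.+ (e ℕ.+ j))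
    lemma′ = solve-∀

  -- Shifting by `e`, which is -l-1, makes the summand f(i-l-1) f(i+l). Now i ↦ -i exchanges the
  -- factors, and its fixed points 0 and m leave the squares of f(l) and f(l+m). This makes the
  -- quadratic term p · p ⋆ linear in p.
  symmetric-autocorrelation-odd : ∀ l → autocorrelation (m ℕ.+ m) f (suc (l ℕ.+ l)) ≡ f l + f (l ℕ.+ m)
  symmetric-autocorrelation-odd l with complement (m ℕ.+ m) (suc l)
  ... | e , n∣l+e = begin
    autocorrelation (m ℕ.+ m) f (suc (l ℕ.+ l))
      ≡⟨ ∑<-shift (autocorrelation-summand per (suc (l ℕ.+ l))) e ⟨
    ∑< (m ℕ.+ m) (λ i → f (e ℕ.+ i) * f (suc (l ℕ.+ l) ℕ.+ (e ℕ.+ i)))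
      ≡⟨ ∑<-reflect-even m (λ i j i+j → trans (cong₂ _*_
           (sm _ _ (subst (m ℕ.+ m ∣_) (lemma l e i j) (n∣ i j i+j)))
           (sm _ _ (subst (m ℕ.+ m ∣_) (lemma′ l e i j) (n∣ i j i+j))))
           (*-comm (f (suc (l ℕ.+ l) ℕ.+ (e ℕ.+ j))) _)) ⟩
    f (e ℕ.+ 0) * f (suc (l ℕ.+ l) ℕ.+ (e ℕ.+ 0)) + f (e ℕ.+ m) * f (suc (l ℕ.+ l) ℕ.+ (e ℕ.+ m))
      ≡⟨ cong₂ _+_
           (trans (cong₂ _*_ (sm _ _ (subst (m ℕ.+ m ∣_) (first₀ l e) n∣l+e)) (second 0))
             (trans (∧-idem (f (l ℕ.+ 0))) (cong f (ℕₚ.+-identityʳ l))))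
           (trans (cong₂ _*_ (sm _ _ (subst (m ℕ.+ m ∣_) (first₁ l e m) (∣m∣n⇒∣m+n n∣l+e ∣-refl))) (second m))
             (∧-idem (f (l ℕ.+ m)))) ⟩
    f l + f (l ℕ.+ m)
      ∎
    where
    n∣ : ∀ i j → i ℕ.+ j ≡ m ℕ.+ m → m ℕ.+ m ∣ (suc l ℕ.+ e) ℕ.+ (suc l ℕ.+ e) ℕ.+ (i ℕ.+ j)
    n∣ i j i+j = ∣m∣n⇒∣m+n (∣m∣n⇒∣m+n n∣l+e n∣l+e) (∣-reflexive (sym i+j))
    lemma : ∀ l e i j → (suc l ℕ.+ e) ℕ.+ (suc l ℕ.+ e) ℕ.+ (i ℕ.+ j) ≡
                        suc ((e ℕ.+ i) ℕ.+ (suc (l ℕ.+ l) ℕ.+ (e ℕ.+ j)))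
    lemma = solve-∀
    lemma′ : ∀ l e i j → (suc l ℕ.+ e) ℕ.+ (suc l ℕ.+ e) ℕ.+ (i ℕ.+ j) ≡
                         suc ((suc (l ℕ.+ l) ℕ.+ (e ℕ.+ i)) ℕ.+ (e ℕ.+ j))
    lemma′ = solve-∀
    first₀ : ∀ l e → suc l ℕ.+ e ≡ suc ((e ℕ.+ 0) ℕ.+ (l ℕ.+ 0))
    first₀ = solve-∀
    first₁ : ∀ l e m → suc l ℕ.+ e ℕ.+ (m ℕ.+ m) ≡ suc ((e ℕ.+ m) ℕ.+ (l ℕ.+ m))
    first₁ = solve-∀
    second : ∀ i → f (suc (l ℕ.+ l) ℕ.+ (e ℕ.+ i)) ≡ f (l ℕ.+ i)
    second i = trans (cong f (index l e i)) (periodic-∣ per n∣l+e (l ℕ.+ i))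
      where
      index : ∀ l e i → suc (l ℕ.+ l) ℕ.+ (e ℕ.+ i) ≡ (suc l ℕ.+ e) ℕ.+ (l ℕ.+ i)
      index = solve-∀

-- The constant 1 as a periodic sequence, and its perturbations

indicator : ℕ → ℕ → 𝔽₂
indicator i k = if does (i ≟ k) then 1# else 0#

∑<-sift : ∀ n {k} → k < n → (f : ℕ → 𝔽₂) → ∑< n (λ i → f i * indicator i k) ≡ f k
∑<-sift (suc n) {zero}  _         f =
  trans (cong₂ _+_ (*-identityʳ (f 0)) (∑<-zero n λ i _ → zeroʳ (f (suc i)))) (+-identityʳ (f 0))
∑<-sift (suc n) {suc k} (s<s k<n) f = cong₂ _+_ (zeroʳ (f 0)) (∑<-sift n k<n (f ∘ suc))

δ : ∀ n .{{_ : NonZero n}} → ℕ → 𝔽₂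
δ n i = indicator (i % n) 0

δ-periodic : ∀ n .{{_ : NonZero n}} → Periodic n (δ n)
δ-periodic n i = cong (λ k → indicator k 0) (trans (cong (_% n) (ℕₚ.+-comm n i)) ([m+n]%n≡m%n i n))

δ-zero : ∀ n .{{_ : NonZero n}} → δ n 0 ≡ 1#
δ-zero n = cong (λ k → indicator k 0) (m<n⇒m%n≡m (ℕ.>-nonZero⁻¹ n))

δ-positive : .{{_ : NonZero n}} → 0 < k → k < n → δ n k ≡ 0#
δ-positive {k = suc k} _ k<n = cong (λ k → indicator k 0) (m<n⇒m%n≡m k<n)

∑<-δ : ∀ n .{{_ : NonZero n}} (f : ℕ → 𝔽₂) → ∑< n (λ i → f i * δ n i) ≡ f 0
∑<-δ n f = begin
  ∑< n (λ i → f i * δ n i)           ≡⟨ ∑<-cong n (λ i i<n → cong (λ k → f i * indicator k 0) (m<n⇒m%n≡m i<n)) ⟩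
  ∑< n (λ i → f i * indicator i 0)   ≡⟨ ∑<-sift n (ℕ.>-nonZero⁻¹ n) f ⟩
  f 0                                ∎

autocorrelation-cong : ∀ n → (∀ i → f i ≡ g i) → ∀ k → autocorrelation n f k ≡ autocorrelation n g k
autocorrelation-cong n eq k = ∑<-cong n λ i _ → cong₂ _*_ (eq i) (eq (k ℕ.+ i))

-- This is the expansion of (1 + p)(1 + p ⋆). One cross term picks out f(k+1); the other picks out
-- f(-1-k), which symmetry turns into f(k). Taking the index as `suc k` gives that term a natural
-- number as its index.
autocorrelation-δ+ : ∀ n .{{_ : NonZero n}} → Symmetric n f → ∀ k →
  autocorrelation n (λ i → δ n i + f i) (suc k) ≡
  δ n (suc k) + ((f (suc k) + f k) + autocorrelation n f (suc k))
autocorrelation-δ+ {f} n sm k with complement n (suc k)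
... | e , n∣k+e = begin
  ∑< n (λ i → (δ n i + f i) * (δ n (suc k ℕ.+ i) + f (suc k ℕ.+ i)))
    ≡⟨ ∑<-cong n (λ i _ → solve 4 (λ a b c d → (a :+ b) :* (c :+ d) := (c :+ d) :* a :+ (b :* c :+ b :* d))
         refl (δ n i) (f i) (δ n (suc k ℕ.+ i)) (f (suc k ℕ.+ i))) ⟩
  ∑< n (λ i → (δ n (suc k ℕ.+ i) + f (suc k ℕ.+ i)) * δ n i +
              (f i * δ n (suc k ℕ.+ i) + f i * f (suc k ℕ.+ i)))
    ≡⟨ trans (∑<-distrib-+ n _ _) (cong₂ _+_ (∑<-δ n λ i → δ n (suc k ℕ.+ i) + f (suc k ℕ.+ i)) (∑<-distrib-+ n _ _)) ⟩
  (δ n (suc k ℕ.+ 0) + f (suc k ℕ.+ 0)) +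
  (∑< n (λ i → f i * δ n (suc k ℕ.+ i)) + autocorrelation n f (suc k))
    ≡⟨ cong₂ (λ j x → (δ n j + f j) + (x + autocorrelation n f (suc k))) (ℕₚ.+-identityʳ (suc k)) cross ⟩
  (δ n (suc k) + f (suc k)) + (f k + autocorrelation n f (suc k))
    ≡⟨ solve 4 (λ a b c d → (a :+ b) :+ (c :+ d) := a :+ ((b :+ c) :+ d)) refl (δ n (suc k)) (f (suc k)) (f k) _ ⟩
  δ n (suc k) + ((f (suc k) + f k) + autocorrelation n f (suc k))
    ∎
  where
  per : Periodic n f
  per = symmetric⇒periodic sm
  cross : ∑< n (λ i → f i * δ n (suc k ℕ.+ i)) ≡ f k
  cross = begin
    ∑< n (λ i → f i * δ n (suc k ℕ.+ i))
      ≡⟨ ∑<-shift {n} (λ i → cong₂ _*_ (per i) (shift-periodic {n} (δ-periodic n) (suc k) i)) e ⟨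
    ∑< n (λ i → f (e ℕ.+ i) * δ n (suc k ℕ.+ (e ℕ.+ i)))
      ≡⟨ ∑<-cong n (λ i _ → cong (f (e ℕ.+ i) *_)
           (trans (cong (δ n) (sym (ℕₚ.+-assoc (suc k) e i))) (periodic-∣ (δ-periodic n) n∣k+e i))) ⟩
    ∑< n (λ i → f (e ℕ.+ i) * δ n i)
      ≡⟨ ∑<-δ n _ ⟩
    f (e ℕ.+ 0)
      ≡⟨ sm (e ℕ.+ 0) k (subst (n ∣_) (lemma k e) n∣k+e) ⟩
    f k ∎
    where
    lemma : ∀ k e → suc k ℕ.+ e ≡ suc ((e ℕ.+ 0) ℕ.+ k)
    lemma = solve-∀

-- The kernel of the linearized equations

even⊎odd : ∀ j → ∃ λ a → j ≡ a ℕ.+ a ⊎ j ≡ suc (a ℕ.+ a)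
even⊎odd zero    = 0 , inj₁ refl
even⊎odd (suc j) with even⊎odd j
... | a , inj₁ refl = a , inj₂ refl
... | a , inj₂ refl = suc a , inj₁ (cong suc (sym (ℕₚ.+-suc a a)))

module _ (u : ℕ) (r : ℕ → 𝔽₂) where

  private
    q m : ℕ
    q = 2 ^ u
    m = q ℕ.+ q

    w : ℕ → 𝔽₂
    w i = r (i ℕ.+ i)

  -- The two families of equations are those satisfied by the difference of two symmetric sequences
  -- p whose δ + p have equal autocorrelations. Of the initial values, r₂ = w₁ starts the
  -- odd-indexed entries of `w` and r₀ = w₀ settles the multiples of m.
  kernel : Periodic (m ℕ.+ m) r → r 0 ≡ 0# → r 2 ≡ 0# →
    (∀ l → r (2 ℕ.+ (l ℕ.+ l)) ≡ r (suc (l ℕ.+ l))) →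
    (∀ l → r (suc (l ℕ.+ l)) + r (l ℕ.+ l) ≡ r l + r (l ℕ.+ m)) →
    ∀ i → r i ≡ 0#
  kernel per r[0] r[2] even odd = r≡0
    where
    r-odd : ∀ l → r (suc (l ℕ.+ l)) ≡ w (suc l)
    r-odd l = trans (sym (even l)) (cong (r ∘ suc) (sym (ℕₚ.+-suc l l)))

    step : ∀ l → w (suc l) + w l ≡ r l + r (l ℕ.+ m)
    step l = trans (cong (_+ w l) (sym (r-odd l))) (odd l)

    step-even : ∀ a → w (suc (a ℕ.+ a)) + w (a ℕ.+ a) ≡ w a + w (a ℕ.+ q)
    step-even a = trans (step (a ℕ.+ a)) (cong (λ k → w a + r k) (lemma a q))
      where
      lemma : ∀ a q → (a ℕ.+ a) ℕ.+ (q ℕ.+ q) ≡ (a ℕ.+ q) ℕ.+ (a ℕ.+ q)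
      lemma = solve-∀

    step-odd : ∀ a → w (suc a ℕ.+ suc a) + w (suc (a ℕ.+ a)) ≡ w (suc a) + w (suc a ℕ.+ q)
    step-odd a = begin
      w (suc a ℕ.+ suc a) + w (suc (a ℕ.+ a))
        ≡⟨ cong (λ k → w (suc k) + w (suc (a ℕ.+ a))) (ℕₚ.+-suc a a) ⟩
      w (suc (suc (a ℕ.+ a))) + w (suc (a ℕ.+ a))
        ≡⟨ step (suc (a ℕ.+ a)) ⟩
      r (suc (a ℕ.+ a)) + r (suc (a ℕ.+ a) ℕ.+ m)
        ≡⟨ cong₂ _+_ (r-odd a) (trans (cong r (lemma a q)) (r-odd (a ℕ.+ q))) ⟩
      w (suc a) + w (suc a ℕ.+ q)
        ∎
      where
      lemma : ∀ a q → suc (a ℕ.+ a) ℕ.+ (q ℕ.+ q) ≡ suc ((a ℕ.+ q) ℕ.+ (a ℕ.+ q))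
      lemma = solve-∀

    -- `step-even` at a+1 and `step-odd` at a have the same right-hand side and share the term
    -- w(2a+2), so w(2a+3) = w(2a+1); the chain starts at w(1) = r(2).
    w-odd : ∀ a → w (suc (a ℕ.+ a)) ≡ 0#
    w-odd zero    = r[2]
    w-odd (suc a) = trans (+-cancel (w (suc a ℕ.+ suc a)) (trans
      (+-comm (w (suc a ℕ.+ suc a)) _) (trans (step-even (suc a)) (trans (sym (step-odd a))
        (+-comm (w (suc a ℕ.+ suc a)) _))))) (w-odd a)

    w-double : ∀ a → w (a ℕ.+ a) ≡ w a + w (a ℕ.+ q)
    w-double a = trans (cong (_+ w (a ℕ.+ a)) (sym (w-odd a))) (step-even a)

    -- Induction on `t` through w(2a) = w(a) + w(a+q). If the next higher power of 2 does not divide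
    -- 2a, then `2 ^ t` divides neither a nor a+q, because the bound on the exponent ensures that it
    -- divides q.
    w-nonmultiple : ∀ t → t ≤ suc u → ∀ j → ¬ 2 ^ t ∣ j → w j ≡ 0#
    w-nonmultiple zero    _         j 1∤j = contradiction (divides j (sym (ℕₚ.*-identityʳ j))) 1∤j
    w-nonmultiple (suc t) (s≤s t≤u) j 2ᵗ∤j with even⊎odd j
    ... | a , inj₂ refl = w-odd a
    ... | a , inj₁ refl = trans (w-double a) (cong₂ _+_
            (w-nonmultiple t (ℕₚ.m≤n⇒m≤1+n t≤u) a 2ᵗ∤a)
            (w-nonmultiple t (ℕₚ.m≤n⇒m≤1+n t≤u) (a ℕ.+ q) λ 2ᵗ∣a+q → 2ᵗ∤a
              (∣m+n∣m⇒∣n (subst (2 ^ t ∣_) (ℕₚ.+-comm a q) 2ᵗ∣a+q) 2ᵗ∣q)))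
      where
      2ᵗ∤a : ¬ 2 ^ t ∣ a
      2ᵗ∤a (divides c refl) = 2ᵗ∤j (divides c (lemma c (2 ^ t)))
        where
        lemma : ∀ c x → c ℕ.* x ℕ.+ c ℕ.* x ≡ c ℕ.* (2 ℕ.* x)
        lemma = solve-∀
      2ᵗ∣q : 2 ^ t ∣ q
      2ᵗ∣q = divides (2 ^ (u ∸ t)) (trans (cong (2 ^_) (sym (ℕₚ.m∸n+n≡m t≤u))) (ℕₚ.^-distribˡ-+-* 2 (u ∸ t) t))

    w-periodic : Periodic m w
    w-periodic i = trans (cong r (lemma m i)) (per (i ℕ.+ i))
      where
      lemma : ∀ m i → (m ℕ.+ i) ℕ.+ (m ℕ.+ i) ≡ (m ℕ.+ m) ℕ.+ (i ℕ.+ i)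
      lemma = solve-∀

    w≡0 : ∀ j → w j ≡ 0#
    w≡0 j with 2 ^ suc u ∣? j
    ... | no  ∤j = w-nonmultiple (suc u) ℕₚ.≤-refl j ∤j
    -- Since `2 ^ suc u` is m, a period of `w`, the value is w(0) = r(0).
    ... | yes ∣j = trans (cong w (sym (ℕₚ.+-identityʳ j)))
                     (trans (periodic-∣ w-periodic (subst (_∣ j) (cong (q ℕ.+_) (ℕₚ.+-identityʳ q)) ∣j) 0) r[0])

    r≡0 : ∀ i → r i ≡ 0#
    r≡0 i with even⊎odd i
    ... | a , inj₁ refl = w≡0 a
    ... | a , inj₂ refl = trans (r-odd a) (w≡0 (suc a))

-- Coefficients of products and reciprocals

lookup≡coeff : ∀ {n} (g : R n) i → lookup g i ≡ coeff g (toℕ i)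
lookup≡coeff (b ∷ g) Fin.zero    = refl
lookup≡coeff (b ∷ g) (Fin.suc i) = lookup≡coeff g i

coeff-tabulate : ∀ (f : ℕ → 𝔽₂) → k < n → coeff (tabulate {n = n} (f ∘ toℕ)) k ≡ f k
coeff-tabulate {k} {n} f k<n = begin
  coeff (tabulate {n = n} (f ∘ toℕ)) k         ≡⟨ cong (coeff (tabulate {n = n} (f ∘ toℕ))) (toℕ-fromℕ< k<n) ⟨
  coeff (tabulate {n = n} (f ∘ toℕ)) (toℕ i)   ≡⟨ lookup≡coeff (tabulate (f ∘ toℕ)) i ⟨
  lookup (tabulate {n = n} (f ∘ toℕ)) i        ≡⟨ lookup∘tabulate (f ∘ toℕ) i ⟩
  f (toℕ i)                                    ≡⟨ cong f (toℕ-fromℕ< k<n) ⟩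
  f k                                          ∎
  where
  i : Fin n
  i = fromℕ< k<n

coeff-≥ : (g : R n) → n ≤ k → coeff g k ≡ 0#
coeff-≥ []      _         = refl
coeff-≥ (b ∷ g) (s≤s n≤k) = coeff-≥ g n≤k

coeff-injective : {g h : R n} → (∀ k → k < n → coeff g k ≡ coeff h k) → g ≡ h
coeff-injective {g = []}    {[]}    eq = refl
coeff-injective {g = b ∷ g} {c ∷ h} eq =
  cong₂ _∷_ (eq 0 z<s) (coeff-injective λ k k<n → eq (suc k) (s<s k<n))

extend : ∀ {n} .{{_ : NonZero n}} → R n → ℕ → 𝔽₂
extend {n} g i = coeff g (i % n)

extend-periodic : ∀ .{{_ : NonZero n}} (g : R n) → Periodic n (extend g)
extend-periodic {n} g i = cong (coeff g) (trans (cong (_% n) (ℕₚ.+-comm n i)) ([m+n]%n≡m%n i n))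

extend-< : ∀ .{{_ : NonZero n}} (g : R n) → k < n → extend g k ≡ coeff g k
extend-< g k<n = cong (coeff g) (m<n⇒m%n≡m k<n)

∑≡∑< : ∀ {n} (F : Fin n → 𝔽₂) (f : ℕ → 𝔽₂) → (∀ i → F i ≡ f (toℕ i)) → ∑[ i < n ] F i ≡ ∑< n f
∑≡∑< {n} F f eq = trans (sum-cong-≗ {n} eq) (sym (∑<≡∑ n f))

-- Modulo `n`, k = i + j means i = k - j, with `n ∸ j` standing for -j. The rewriting isolates the
-- summation index in the form required by `∑<-sift`.
indicator-rotate : ∀ {n} .{{_ : NonZero n}} {i j k} → i < n → j ≤ n → k < n →
  indicator k ((i ℕ.+ j) % n) ≡ indicator i ((k ℕ.+ (n ∸ j)) % n)
indicator-rotate {n} {i} {j} {k} i<n j≤n k<n = cong (λ b → if b then 1# else 0#)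
  (does-⇔ (mk⇔ (λ { k≡ → sym (turn i<n k≡ (ℕₚ.m+[n∸m]≡n j≤n)) })
               (λ { i≡ → sym (turn k<n i≡ (ℕₚ.m∸n+n≡m j≤n)) }))
          (k ≟ (i ℕ.+ j) % n) (i ≟ (k ℕ.+ (n ∸ j)) % n))
  where
  turn : ∀ {a b c d} → a < n → d ≡ (a ℕ.+ b) % n → b ℕ.+ c ≡ n → (d ℕ.+ c) % n ≡ a
  turn {a} {b} {c} a<n refl b+c = begin
    ((a ℕ.+ b) % n ℕ.+ c) % n            ≡⟨ %-distribˡ-+ ((a ℕ.+ b) % n) c n ⟩
    ((a ℕ.+ b) % n % n ℕ.+ c % n) % n    ≡⟨ cong (λ x → (x ℕ.+ c % n) % n) (m%n%n≡m%n (a ℕ.+ b) n) ⟩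
    ((a ℕ.+ b) % n ℕ.+ c % n) % n        ≡⟨ %-distribˡ-+ (a ℕ.+ b) c n ⟨
    (a ℕ.+ b ℕ.+ c) % n                  ≡⟨ cong (_% n) (trans (ℕₚ.+-assoc a b c) (cong (a ℕ.+_) b+c)) ⟩
    (a ℕ.+ n) % n                        ≡⟨ [m+n]%n≡m%n a n ⟩
    a % n                                ≡⟨ m<n⇒m%n≡m a<n ⟩
    a                                    ∎

lookup-z^ : ∀ {n} .{{_ : NonZero n}} e (k : Fin n) → lookup (z^ e) k ≡ indicator (toℕ k) (e % n)
lookup-z^ e k = lookup∘tabulate _ k

coeff-⋆ : ∀ {n} .{{_ : NonZero n}} (g : R n) → k < n → coeff (g ⋆) k ≡ extend g (n ∸ k)
coeff-⋆ {k} {n} g k<n = begin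
  coeff (g ⋆) k
    ≡⟨ cong (coeff (g ⋆)) (toℕ-fromℕ< k<n) ⟨
  coeff (g ⋆) (toℕ i)
    ≡⟨ trans (sym (lookup≡coeff (g ⋆) i)) (lookup∘tabulate _ i) ⟩
  ∑[ j < n ] (lookup g j * lookup (z^ (n ∸ toℕ j)) i)
    ≡⟨ ∑≡∑< {n} _ _ (λ j → cong₂ _*_ (lookup≡coeff g j)
         (trans (lookup-z^ (n ∸ toℕ j) i) (cong (λ k → indicator k ((n ∸ toℕ j) % n)) (toℕ-fromℕ< k<n)))) ⟩
  ∑< n (λ j → coeff g j * indicator k ((n ∸ j) % n))
    ≡⟨ ∑<-cong n (λ j j<n → cong (coeff g j *_) (flip j<n)) ⟩
  ∑< n (λ j → coeff g j * indicator j ((n ∸ k) % n))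
    ≡⟨ ∑<-sift n (m%n<n (n ∸ k) n) (coeff g) ⟩
  extend g (n ∸ k)
    ∎
  where
  i : Fin n
  i = fromℕ< k<n
  -- Both sides test whether j + k is 0 modulo `n`.
  flip : ∀ {j} → j < n → indicator k ((n ∸ j) % n) ≡ indicator j ((n ∸ k) % n)
  flip {j} j<n = begin
    indicator k ((n ∸ j) % n)   ≡⟨ indicator-rotate k<n (ℕₚ.<⇒≤ j<n) (ℕ.>-nonZero⁻¹ n) ⟨
    indicator 0 ((k ℕ.+ j) % n) ≡⟨ cong (λ e → indicator 0 (e % n)) (ℕₚ.+-comm k j) ⟩
    indicator 0 ((j ℕ.+ k) % n) ≡⟨ indicator-rotate j<n (ℕₚ.<⇒≤ k<n) (ℕ.>-nonZero⁻¹ n) ⟩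
    indicator j ((n ∸ k) % n)   ∎

coeff-· : ∀ {n} .{{_ : NonZero n}} (g h : R n) → k < n →
  coeff (g · h) k ≡ ∑< n (λ j → coeff h j * extend g (k ℕ.+ (n ∸ j)))
coeff-· {k} {n} g h k<n = begin
  coeff (g · h) k
    ≡⟨ cong (coeff (g · h)) (toℕ-fromℕ< k<n) ⟨
  coeff (g · h) (toℕ κ)
    ≡⟨ trans (sym (lookup≡coeff (g · h) κ)) (lookup∘tabulate _ κ) ⟩
  ∑[ i < n ] (∑[ j < n ] ((lookup g i * lookup h j) * lookup (z^ (toℕ i ℕ.+ toℕ j)) κ))
    ≡⟨ ∑≡∑< {n} _ _ (λ i → ∑≡∑< {n} _ _ (λ j →
         cong₂ _*_ (cong₂ _*_ (lookup≡coeff g i) (lookup≡coeff h j))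
           (trans (lookup-z^ (toℕ i ℕ.+ toℕ j) κ)
             (cong (λ k → indicator k ((toℕ i ℕ.+ toℕ j) % n)) (toℕ-fromℕ< k<n))))) ⟩
  ∑< n (λ i → ∑< n (λ j → (coeff g i * coeff h j) * indicator k ((i ℕ.+ j) % n)))
    ≡⟨ ∑<-comm n n _ ⟩
  ∑< n (λ j → ∑< n (λ i → (coeff g i * coeff h j) * indicator k ((i ℕ.+ j) % n)))
    -- For fixed `j` only the index i = k - j survives.
    ≡⟨ ∑<-cong n (λ j j<n → trans
         (∑<-cong n λ i i<n → trans
           (cong ((coeff g i * coeff h j) *_) (indicator-rotate i<n (ℕₚ.<⇒≤ j<n) k<n))
           (solve 3 (λ a b c → (a :* b) :* c := b :* (a :* c)) refl (coeff g i) (coeff h j) _))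
         (trans (sym (*-distribˡ-∑< n (coeff h j) _))
           (cong (coeff h j *_) (∑<-sift n (m%n<n _ n) (coeff g))))) ⟩
  ∑< n (λ j → coeff h j * extend g (k ℕ.+ (n ∸ j)))
    ∎
  where
  κ : Fin n
  κ = fromℕ< k<n

coeff-·⋆ : ∀ {n} .{{_ : NonZero n}} (g : R n) → k < n →
  coeff (g · g ⋆) k ≡ autocorrelation n (extend g) k
coeff-·⋆ {k} {n} g k<n = begin
  coeff (g · g ⋆) k
    ≡⟨ coeff-· g (g ⋆) k<n ⟩
  ∑< n (λ j → coeff (g ⋆) j * extend g (k ℕ.+ (n ∸ j)))
    ≡⟨ ∑<-cong n (λ j j<n → cong (_* extend g (k ℕ.+ (n ∸ j))) (coeff-⋆ g j<n)) ⟩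
  ∑< n (λ j → F (n ∸ j))
    -- Reversal gives the indices 1, ..., n, and a shift by 1 brings them back to 0, ..., n-1.
    ≡⟨ ∑<-reverse n (λ { i j refl → cong F (trans (cong (_∸ i) (sym (ℕₚ.+-suc i j))) (ℕₚ.m+n∸m≡n i (suc j))) }) ⟩
  ∑< n (λ j → F (suc j))
    ≡⟨ ∑<-shift {n} (autocorrelation-summand {n} (extend-periodic g) k) 1 ⟩
  ∑< n F ∎
  where
  F : ℕ → 𝔽₂
  F i = extend g i * extend g (k ℕ.+ i)

-- Injective self-maps of finite sets

injective⇒surjective : ∀ {N} (f : Fin N → Fin N) → (∀ {x y} → f x ≡ f y → x ≡ y) → ∀ y → ∃ λ x → f x ≡ y
injective⇒surjective {N} f inj y with any? (λ x → f x Finₚ.≟ y)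
... | yes hit  = hit
... | no  miss with pigeonhole (ℕₚ.n<1+n N) f′
  where
  -- If `f` misses `y`, one further argument can be sent to `y` without a collision, contradicting
  -- the pigeonhole principle.
  f′ : Fin (suc N) → Fin N
  f′ Fin.zero    = y
  f′ (Fin.suc x) = f x
...   | Fin.zero  , Fin.suc j , _   , eq = contradiction (j , sym eq) miss
...   | Fin.suc i , Fin.suc j , i<j , eq = contradiction (cong toℕ (inj eq)) (ℕₚ.<⇒≢ (s<s⁻¹ i<j))

funToFin-cong : ∀ {m n} {f g : Fin m → Fin n} → (∀ i → f i ≡ g i) → funToFin f ≡ funToFin g
funToFin-cong {zero}  eq = refl
funToFin-cong {suc m} eq = cong₂ combine (eq Fin.zero) (funToFin-cong (eq ∘ Fin.suc))

-- `R n` is put in bijection with `Fin (2 ^ n)` by reading coefficients as binary digits.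
vec-injective⇒surjective : (T : R n → R n) → (∀ {v w} → T v ≡ T w → v ≡ w) → ∀ y → ∃ λ v → T v ≡ y
vec-injective⇒surjective {n} T inj y =
  let x , eq = injective⇒surjective (encode ∘ T ∘ decode)
                 (λ eq → decode-injective (inj (encode-injective eq))) (encode y)
  in decode x , encode-injective eq
  where
  open Inverse 2↔Bool
  encode : R n → Fin (2 ^ n)
  encode v = funToFin (from ∘ lookup v)
  decode : Fin (2 ^ n) → R n
  decode k = tabulate (to ∘ finToFun {2} {n} k)
  decode-encode : ∀ v → decode (encode v) ≡ v
  decode-encode v = trans
    (tabulate-cong λ i → trans (cong to (finToFun-funToFin (from ∘ lookup v) i)) (strictlyInverseˡ (lookup v i)))
    (tabulate∘lookup v)
  encode-decode : ∀ k → encode (decode k) ≡ k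
  encode-decode k = trans
    (funToFin-cong λ i → trans (cong from (lookup∘tabulate (to ∘ finToFun {2} {n} k) i)) (strictlyInverseʳ _))
    (funToFin-finToFin {n} {2} k)
  encode-injective : ∀ {v w} → encode v ≡ encode w → v ≡ w
  encode-injective {v} {w} eq = trans (sym (decode-encode v)) (trans (cong decode eq) (decode-encode w))
  decode-injective : ∀ {k l} → decode k ≡ decode l → k ≡ l
  decode-injective {k} {l} eq = trans (sym (encode-decode k)) (trans (cong encode eq) (encode-decode l))

-- Symmetry checked on residues

residue-complement : ∀ n .{{_ : NonZero n}} i j → n ∣ suc (i ℕ.+ j) → suc (i % n ℕ.+ j % n) ≡ n
residue-complement n i j n∣ with ∣m+n∣m⇒∣n (subst (n ∣_) regroup n∣) (n∣m*n (i / n ℕ.+ j / n))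
  where
  lemma : ∀ a b c d n → suc ((a ℕ.+ c ℕ.* n) ℕ.+ (b ℕ.+ d ℕ.* n)) ≡ (c ℕ.+ d) ℕ.* n ℕ.+ suc (a ℕ.+ b)
  lemma = solve-∀
  regroup : suc (i ℕ.+ j) ≡ (i / n ℕ.+ j / n) ℕ.* n ℕ.+ suc (i % n ℕ.+ j % n)
  regroup = trans (cong₂ (λ x y → suc (x ℕ.+ y)) (m≡m%n+[m/n]*n i n) (m≡m%n+[m/n]*n j n))
                  (lemma (i % n) (j % n) (i / n) (j / n) n)
-- The sum of the residues plus 1 is positive and less than 2n, so the only multiple of `n` it can
-- be is `n` itself.
... | divides 1 eq             = trans eq (ℕₚ.+-identityʳ n)
... | divides (suc (suc c)) eq = contradiction bound (ℕₚ.<⇒≱ (subst (_< n ℕ.+ n) eq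
        (ℕₚ.+-mono-≤-< (m%n<n i n) (m%n<n j n))))
  where
  bound : n ℕ.+ n ≤ suc (suc c) ℕ.* n
  bound = ℕₚ.+-monoʳ-≤ n (ℕₚ.m≤m+n n (c ℕ.* n))

-- After reduction modulo 2m the two indices add up to 2m-1, so one of them lies below m.
symmetric-from-half : ∀ m .{{_ : NonZero (m ℕ.+ m)}} → Periodic (m ℕ.+ m) f →
  (∀ i j → suc (i ℕ.+ j) ≡ m ℕ.+ m → i < m → f i ≡ f j) → Symmetric (m ℕ.+ m) f
symmetric-from-half {f} m per half i j n∣ = begin
  f i              ≡⟨ periodic-% per i ⟨
  f (i % n′)       ≡⟨ reduced (residue-complement n′ i j n∣) ⟩
  f (j % n′)       ≡⟨ periodic-% per j ⟩
  f j              ∎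
  where
  n′ : ℕ
  n′ = m ℕ.+ m
  reduced : ∀ {i j} → suc (i ℕ.+ j) ≡ m ℕ.+ m → f i ≡ f j
  reduced {i} {j} i+j with i ℕₚ.<? m | j ℕₚ.<? m
  ... | yes i<m | _       = half i j i+j i<m
  ... | no  _   | yes j<m = sym (half j i (trans (cong suc (ℕₚ.+-comm j i)) i+j) j<m)
  ... | no  i≮m | no  j≮m = contradiction (ℕₚ.+-mono-≤ (ℕₚ.≮⇒≥ i≮m) (ℕₚ.≮⇒≥ j≮m))
                              (ℕₚ.<⇒≱ (ℕₚ.≤-reflexive i+j))

-- The set `H` in terms of coefficient sequences

half-+ : ∀ m → (m ℕ.+ m) / 2 ≡ m
half-+ m = trans (cong (_/ 2) (lemma m)) (m*n/n≡m m 2)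
  where
  lemma : ∀ m → m ℕ.+ m ≡ m ℕ.* 2
  lemma = solve-∀

∑<-odd-index : ∀ q (f : ℕ → 𝔽₂) →
  ∑< (q ℕ.+ q) (λ i → if does (i % 2 ≟ 1) then f i else 0#) ≡ ∑< q (λ t → f (suc (t ℕ.+ t)))
∑<-odd-index q f = trans (∑<-pairs q _) (trans
  (cong (_+ ∑< q (λ i → if does (suc (i ℕ.+ i) % 2 ≟ 1) then f (suc (i ℕ.+ i)) else 0#))
    (∑<-zero q λ i _ → cong (λ k → if does (k ≟ 1) then f (i ℕ.+ i) else 0#)
      (trans (cong (_% 2) (lemma i)) ([m+kn]%n≡m%n 0 i 2))))
  (∑<-cong q λ i _ → cong (λ k → if does (k ≟ 1) then f (suc (i ℕ.+ i)) else 0#)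
      (trans (cong (λ k → suc k % 2) (lemma i)) ([m+kn]%n≡m%n 1 i 2))))
  where
  lemma : ∀ i → i ℕ.+ i ≡ i ℕ.* 2
  lemma = solve-∀

-- The conditions defining H, on coefficient sequences and with n = 4q.
record IsH (q : ℕ) (a : ℕ → 𝔽₂) : Set where
  field
    odd-sum   : ∑< q (λ t → a (suc (t ℕ.+ t))) ≡ 0#
    constant  : a 0 ≡ 1#
    middle    : a (q ℕ.+ q) ≡ 0#
    symmetric : ∀ i j → 0 < i → i < q ℕ.+ q → i ℕ.+ j ≡ (q ℕ.+ q) ℕ.+ (q ℕ.+ q) → a i ≡ a j

autocorrelation-IsH : ∀ q → Periodic ((q ℕ.+ q) ℕ.+ (q ℕ.+ q)) f →
  autocorrelation ((q ℕ.+ q) ℕ.+ (q ℕ.+ q)) f 0 ≡ 1# →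
  IsH q (autocorrelation ((q ℕ.+ q) ℕ.+ (q ℕ.+ q)) f)
autocorrelation-IsH q per a[0]≡1 = record
  { odd-sum   = autocorrelation-odd-sum q per a[0]≡1
  ; constant  = a[0]≡1
  ; middle    = autocorrelation-middle (q ℕ.+ q) per
  ; symmetric = λ i j _ _ i+j → autocorrelation-even per (∣-reflexive (sym i+j))
  }

suc-double-< : ∀ {t q} → t < q → suc (t ℕ.+ t) < q ℕ.+ q
suc-double-< {t} {q} t<q = subst (_≤ q ℕ.+ q) (ℕₚ.+-suc (suc t) t) (ℕₚ.+-mono-≤ t<q t<q)

module _ (q : ℕ) .{{_ : NonZero q}} where

  private
    m n′ : ℕ
    m = q ℕ.+ q
    n′ = m ℕ.+ m

    instance
      m≢0 : NonZero m
      m≢0 = ℕ.>-nonZero (ℕₚ.<-≤-trans (ℕ.>-nonZero⁻¹ q) (ℕₚ.m≤m+n q q))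
      n′≢0 : NonZero n′
      n′≢0 = ℕ.>-nonZero (ℕₚ.<-≤-trans (ℕ.>-nonZero⁻¹ m) (ℕₚ.m≤m+n m m))

    0<m : 0 < m
    0<m = ℕ.>-nonZero⁻¹ m
    0<n : 0 < n′
    0<n = ℕ.>-nonZero⁻¹ n′
    m<n : m < n′
    m<n = ℕₚ.m<m+n m 0<m

  -- The entries at 2, ..., m-1 are the free coordinates of `H`: those at 0 and m are prescribed,
  -- the odd sum then yields the entry at 1, and symmetry yields those beyond m.
  IsH-determined : ∀ {a b} → IsH q a → IsH q b → (∀ k → 2 ≤ k → k < m → a k ≡ b k) → ∀ k → k < n′ → a k ≡ b k
  IsH-determined {a} {b} A B eq = agree
    where
    module A = IsH A
    module B = IsH B

    -- A fresh `q` is quantified here so that it can be matched against `suc`, which splits the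
    -- entry at 1 off the odd sum.
    a[1]≡b[1] : ∀ q → (∀ k → 2 ≤ k → k < q ℕ.+ q → a k ≡ b k) →
      ∑< q (λ t → a (suc (t ℕ.+ t))) ≡ 0# → ∑< q (λ t → b (suc (t ℕ.+ t))) ≡ 0# → 0 < q → a 1 ≡ b 1
    a[1]≡b[1] (suc q) eq a-odd b-odd _ = +-cancel S (begin
      S + a 1   ≡⟨ +-comm S (a 1) ⟩
      a 1 + S   ≡⟨ trans a-odd (sym b-odd) ⟩
      b 1 + _   ≡⟨ cong (b 1 +_) (∑<-cong q λ t t<q → eq _ (s≤s (s≤s z≤n)) (suc-double-< (s<s t<q))) ⟨
      b 1 + S   ∎)
      where
      S : 𝔽₂
      S = ∑< q (λ t → a (suc (suc t ℕ.+ suc t)))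

    lower : ∀ k → k < m → a k ≡ b k
    lower zero          _   = trans A.constant (sym B.constant)
    lower (suc zero)    _   = a[1]≡b[1] q eq A.odd-sum B.odd-sum (ℕ.>-nonZero⁻¹ q)
    lower (suc (suc k)) k<m = eq (2 ℕ.+ k) (s≤s (s≤s z≤n)) k<m

    agree : ∀ k → k < n′ → a k ≡ b k
    agree k k<n with ℕₚ.<-cmp k m
    ... | tri< k<m _ _  = lower k k<m
    ... | tri≈ _ refl _ = trans A.middle (sym B.middle)
    ... | tri> _ _ m<k  = trans (sym (A.symmetric j k 0<j j<m j+k)) (trans (lower j j<m) (B.symmetric j k 0<j j<m j+k))
      where
      j : ℕ
      j = n′ ∸ k
      0<j : 0 < j
      0<j = ℕₚ.m<n⇒0<n∸m k<n
      j+k : j ℕ.+ k ≡ n′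
      j+k = ℕₚ.m∸n+n≡m (ℕₚ.<⇒≤ k<n)
      j<m : j < m
      j<m = ℕₚ.+-cancelʳ-< k j m (subst (_< m ℕ.+ k) (sym j+k) (ℕₚ.+-monoʳ-< m m<k))

  H⇒IsH : {h : R n′} → h ∈ H → IsH q (coeff h)
  H⇒IsH {h} h∈H = record
    { odd-sum   = trans (sym (∑<-odd-index q (coeff h)))
                    (trans (cong (λ k → ∑< k φ) (sym (half-+ m))) (trans (∑<≡∑ (n′ / 2) φ) odd-sum))
    ; constant  = constant
    ; middle    = trans (cong (coeff h) (sym (half-+ m))) middle
    ; symmetric = λ i j 0<i i<m i+j → trans
        (symmetric i 0<i (subst (λ k → i ≤ k ∸ 1) (sym (half-+ m)) (ℕₚ.∸-monoˡ-≤ 1 i<m)))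
        (cong (coeff h) (trans (cong (_∸ i) (sym i+j)) (ℕₚ.m+n∸m≡n i j)))
    }
    where
    open H h∈H
    φ : ℕ → 𝔽₂
    φ i = if does (i % 2 ≟ 1) then coeff h i else 0#

  pred-half-< : ∀ {i} → 1 ≤ i → i ≤ n′ / 2 ∸ 1 → i < m
  pred-half-< {i} 1≤i i≤ = ℕₚ.≤-<-trans (subst (λ k → i ≤ k ∸ 1) (half-+ m) i≤) (ℕₚ.∸-monoʳ-< {m} (s≤s z≤n) 0<m)

  IsH⇒H : {a : ℕ → 𝔽₂} {h : R n′} → IsH q a → (∀ k → k < n′ → coeff h k ≡ a k) → h ∈ H
  IsH⇒H {a} {h} A eq = record
    { odd-sum   = trans (sym (∑<≡∑ (n′ / 2) φ)) (trans (cong (λ k → ∑< k φ) (half-+ m))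
                    (trans (∑<-odd-index q (coeff h))
                      (trans (∑<-cong q λ t t<q → eq _ (ℕₚ.<-trans (suc-double-< t<q) m<n)) odd-sum)))
    ; constant  = trans (eq 0 0<n) constant
    ; middle    = trans (cong (coeff h) (half-+ m)) (trans (eq m m<n) middle)
    ; symmetric = λ i 1≤i i≤ →
        let i<m = pred-half-< 1≤i i≤
            i<n = ℕₚ.<-trans i<m m<n
        in trans (eq i i<n) (trans (symmetric i (n′ ∸ i) 1≤i i<m (ℕₚ.m+[n∸m]≡n (ℕₚ.<⇒≤ i<n)))
             (sym (eq (n′ ∸ i) (ℕₚ.∸-monoʳ-< 1≤i (ℕₚ.<⇒≤ i<n)))))
    }
    where
    open IsH A
    φ : ℕ → 𝔽₂
    φ i = if does (i % 2 ≟ 1) then coeff h i else 0#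

  -- Only A(0) = 1 is to be shown. As `autocorrelation-δ+` covers positive indices only, A(0) is
  -- read as A(n): there δ gives 1, f(n) and f(n-1) are mirror images and cancel, and the
  -- autocorrelation of `f` vanishes at the even index n = 2c+2.
  autocorrelation-δ+-IsH : Symmetric n′ f → IsH q (autocorrelation n′ (λ i → δ n′ i + f i))
  autocorrelation-δ+-IsH {f} sm = autocorrelation-IsH q per A[0]≡1
    where
    b : ℕ → 𝔽₂
    b i = δ n′ i + f i
    per : Periodic n′ b
    per i = cong₂ _+_ (δ-periodic n′ i) (symmetric⇒periodic sm i)
    c : ℕ
    c = ℕ.pred m
    suc-c : suc c ≡ m
    suc-c = ℕₚ.suc-pred m
    n≡ : n′ ≡ suc (suc (c ℕ.+ c))
    n≡ = sym (trans (cong suc (sym (ℕₚ.+-suc c c))) (cong₂ ℕ._+_ suc-c suc-c))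
    A[0]≡1 : autocorrelation n′ b 0 ≡ 1#
    A[0]≡1 = begin
      autocorrelation n′ b 0
        ≡⟨ autocorrelation-periodic {n′} per 0 ⟨
      autocorrelation n′ b (n′ ℕ.+ 0)
        ≡⟨ cong (autocorrelation n′ b) (trans (ℕₚ.+-identityʳ n′) n≡) ⟩
      autocorrelation n′ b (suc (suc (c ℕ.+ c)))
        ≡⟨ autocorrelation-δ+ n′ sm (suc (c ℕ.+ c)) ⟩
      δ n′ (suc (suc (c ℕ.+ c))) +
        ((f (suc (suc (c ℕ.+ c))) + f (suc (c ℕ.+ c))) + autocorrelation n′ f (suc (suc (c ℕ.+ c))))
        ≡⟨ cong₂ _+_
             (trans (cong (δ n′) (trans (sym n≡) (sym (ℕₚ.+-identityʳ n′)))) (trans (δ-periodic n′ 0) (δ-zero n′)))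
             (cong₂ _+_
               (trans (cong (_+ f (suc (c ℕ.+ c)))
                  (sm _ _ (subst (n′ ∣_)
                    (trans (cong₂ ℕ._+_ n≡ n≡) (ℕₚ.+-suc (suc (suc (c ℕ.+ c))) (suc (c ℕ.+ c))))
                    (∣m∣n⇒∣m+n ∣-refl ∣-refl))))
                  (xor-same (f (suc (c ℕ.+ c)))))
               (trans (cong (autocorrelation n′ f ∘ suc) (sym (ℕₚ.+-suc c c)))
                 (symmetric-autocorrelation-even m f sm (suc c)))) ⟩
      1# ∎

-- Uniqueness of the factorization in `G`

regroup-differences : ∀ x y x′ y′ (z : 𝔽₂) → (x + y) + z ≡ (x′ + y′) + z → x + x′ ≡ y + y′
regroup-differences x y x′ y′ z eq = begin
  x + x′
    ≡⟨ solve 5 (λ x y x′ y′ z → x :+ x′ := (((x :+ y) :+ z) :+ ((x′ :+ y′) :+ z)) :+ (y :+ y′)) refl x y x′ y′ z ⟩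
  (((x + y) + z) + ((x′ + y′) + z)) + (y + y′)
    ≡⟨ cong (λ s → (s + ((x′ + y′) + z)) + (y + y′)) eq ⟩
  (((x′ + y′) + z) + ((x′ + y′) + z)) + (y + y′)
    ≡⟨ cong (_+ (y + y′)) (xor-same ((x′ + y′) + z)) ⟩
  y + y′
    ∎

module _ (u : ℕ) where

  private
    q m n′ : ℕ
    q = 2 ^ u
    m = q ℕ.+ q
    n′ = m ℕ.+ m

    instance
      q≢0 : NonZero q
      q≢0 = ℕₚ.m^n≢0 2 u
      m≢0 : NonZero m
      m≢0 = ℕ.>-nonZero (ℕₚ.<-≤-trans (ℕ.>-nonZero⁻¹ q) (ℕₚ.m≤m+n q q))
      n′≢0 : NonZero n′
      n′≢0 = ℕ.>-nonZero (ℕₚ.<-≤-trans (ℕ.>-nonZero⁻¹ m) (ℕₚ.m≤m+n m m))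

    0<m : 0 < m
    0<m = ℕ.>-nonZero⁻¹ m
    1<m : 1 < m
    1<m = ℕₚ.+-mono-≤ (ℕ.>-nonZero⁻¹ q) (ℕ.>-nonZero⁻¹ q)
    m<n : m < n′
    m<n = ℕₚ.m<m+n m 0<m
    0<n : 0 < n′
    0<n = ℕₚ.<-trans 0<m m<n
    3<n : 3 < n′
    3<n = ℕₚ.+-mono-≤ 1<m 1<m
    2<n : 2 < n′
    2<n = ℕₚ.<-trans (ℕₚ.n<1+n 2) 3<n

    δ+_ : (ℕ → 𝔽₂) → ℕ → 𝔽₂
    (δ+ p) i = δ n′ i + p i

    A : (ℕ → 𝔽₂) → ℕ → 𝔽₂
    A = autocorrelation n′

  -- For symmetric p, the autocorrelation of δ + p is affine in p, so the difference r = p + p′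
  -- satisfies the homogeneous equations of `kernel`.
  symmetric-determined : ∀ {p p′} → Symmetric n′ p → Symmetric n′ p′ → p 0 ≡ p′ 0 → p 2 ≡ p′ 2 →
    (∀ k → k < n′ → A (δ+ p) k ≡ A (δ+ p′) k) → ∀ i → p i ≡ p′ i
  symmetric-determined {p} {p′} sm sm′ eq₀ eq₂ eq i = begin
    p i                    ≡⟨ solve 2 (λ x y → x := (x :+ y) :+ y) refl (p i) (p′ i) ⟩
    (p i + p′ i) + p′ i    ≡⟨ cong (_+ p′ i) (kernel u r (λ i → cong₂ _+_ (per i) (per′ i))
                                (trans (cong (_+ p′ 0) eq₀) (xor-same (p′ 0)))
                                (trans (cong (_+ p′ 2) eq₂) (xor-same (p′ 2)))
                                r-even r-odd i) ⟩
    p′ i                   ∎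
    where
    r : ℕ → 𝔽₂
    r i = p i + p′ i
    per : Periodic n′ p
    per = symmetric⇒periodic sm
    per′ : Periodic n′ p′
    per′ = symmetric⇒periodic sm′

    δ+-periodic : ∀ {p} → Periodic n′ p → Periodic n′ (δ+ p)
    δ+-periodic per i = cong₂ _+_ (δ-periodic n′ i) (per i)

    A-eq : ∀ k → A (δ+ p) k ≡ A (δ+ p′) k
    A-eq k = begin
      A (δ+ p) k            ≡⟨ periodic-% (autocorrelation-periodic {n′} (δ+-periodic per)) k ⟨
      A (δ+ p) (k % n′)     ≡⟨ eq (k % n′) (m%n<n k n′) ⟩
      A (δ+ p′) (k % n′)    ≡⟨ periodic-% (autocorrelation-periodic {n′} (δ+-periodic per′)) k ⟩
      A (δ+ p′) k           ∎

    fold-eq : ∀ k → (p (suc k) + p k) + A p (suc k) ≡ (p′ (suc k) + p′ k) + A p′ (suc k)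
    fold-eq k = +-cancel (δ n′ (suc k)) (begin
      δ n′ (suc k) + ((p (suc k) + p k) + A p (suc k))     ≡⟨ autocorrelation-δ+ n′ sm k ⟨
      A (δ+ p) (suc k)                                     ≡⟨ A-eq (suc k) ⟩
      A (δ+ p′) (suc k)                                    ≡⟨ autocorrelation-δ+ n′ sm′ k ⟩
      δ n′ (suc k) + ((p′ (suc k) + p′ k) + A p′ (suc k))  ≡⟨ +-comm (δ n′ (suc k)) _ ⟩
      ((p′ (suc k) + p′ k) + A p′ (suc k)) + δ n′ (suc k)  ∎)

    A-even : ∀ {p} → Symmetric n′ p → ∀ l → A p (2 ℕ.+ (l ℕ.+ l)) ≡ 0#
    A-even {p} sm l = trans (cong (A p ∘ suc) (sym (ℕₚ.+-suc l l))) (symmetric-autocorrelation-even m p sm (suc l))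

    r-even : ∀ l → r (2 ℕ.+ (l ℕ.+ l)) ≡ r (suc (l ℕ.+ l))
    r-even l = regroup-differences
      (p (2 ℕ.+ (l ℕ.+ l))) (p (suc (l ℕ.+ l))) (p′ (2 ℕ.+ (l ℕ.+ l))) (p′ (suc (l ℕ.+ l))) 0# (begin
      (p (2 ℕ.+ (l ℕ.+ l)) + p (suc (l ℕ.+ l))) + 0#
        ≡⟨ cong ((p (2 ℕ.+ (l ℕ.+ l)) + p (suc (l ℕ.+ l))) +_) (A-even sm l) ⟨
      (p (2 ℕ.+ (l ℕ.+ l)) + p (suc (l ℕ.+ l))) + A p (2 ℕ.+ (l ℕ.+ l))
        ≡⟨ fold-eq (suc (l ℕ.+ l)) ⟩
      (p′ (2 ℕ.+ (l ℕ.+ l)) + p′ (suc (l ℕ.+ l))) + A p′ (2 ℕ.+ (l ℕ.+ l))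
        ≡⟨ cong ((p′ (2 ℕ.+ (l ℕ.+ l)) + p′ (suc (l ℕ.+ l))) +_) (A-even sm′ l) ⟩
      (p′ (2 ℕ.+ (l ℕ.+ l)) + p′ (suc (l ℕ.+ l))) + 0#
        ∎)

    r-odd : ∀ l → r (suc (l ℕ.+ l)) + r (l ℕ.+ l) ≡ r l + r (l ℕ.+ m)
    r-odd l = begin
      (a + a′) + (b + b′)
        ≡⟨ solve 4 (λ a a′ b b′ → (a :+ a′) :+ (b :+ b′) := (a :+ b) :+ (a′ :+ b′)) refl a a′ b b′ ⟩
      (a + b) + (a′ + b′)
        ≡⟨ regroup-differences (a + b) (c + d) (a′ + b′) (c′ + d′) 0# differences ⟩
      (c + d) + (c′ + d′)
        ≡⟨ solve 4 (λ c d c′ d′ → (c :+ d) :+ (c′ :+ d′) := (c :+ c′) :+ (d :+ d′)) refl c d c′ d′ ⟩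
      (c + c′) + (d + d′)
        ∎
      where
      a a′ b b′ c c′ d d′ : 𝔽₂
      a  = p (suc (l ℕ.+ l))
      a′ = p′ (suc (l ℕ.+ l))
      b  = p (l ℕ.+ l)
      b′ = p′ (l ℕ.+ l)
      c  = p l
      c′ = p′ l
      d  = p (l ℕ.+ m)
      d′ = p′ (l ℕ.+ m)
      differences : ((a + b) + (c + d)) + 0# ≡ ((a′ + b′) + (c′ + d′)) + 0#
      differences = cong (_+ 0#) (begin
        (a + b) + (c + d)                      ≡⟨ cong ((a + b) +_) (symmetric-autocorrelation-odd m p sm l) ⟨
        (a + b) + A p (suc (l ℕ.+ l))          ≡⟨ fold-eq (l ℕ.+ l) ⟩
        (a′ + b′) + A p′ (suc (l ℕ.+ l))       ≡⟨ cong ((a′ + b′) +_) (symmetric-autocorrelation-odd m p′ sm′ l) ⟩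
        (a′ + b′) + (c′ + d′)                  ∎)

  module _ (g : R n′) (g∈G : g ∈ G) where
    open G g∈G

    perturbation : ℕ → 𝔽₂
    perturbation i = δ n′ i + extend g i

    perturbation-0 : perturbation 0 ≡ 0#
    perturbation-0 = cong₂ _+_ (δ-zero n′) (trans (extend-< g 0<n) constant)

    perturbation-2 : perturbation 2 ≡ 0#
    perturbation-2 = cong₂ _+_ (δ-positive z<s 2<n) (trans (extend-< g 2<n) second)

    -- Subtracting 1 removes the only asymmetry of `g`: at the pair 0, n-1 both values become 0. At
    -- the pair 2, n-3, left out of the symmetry condition of `G`, both coefficients are 0 by
    -- definition.
    perturbation-symmetric : Symmetric n′ perturbation
    perturbation-symmetric = symmetric-from-half m (λ i → cong₂ _+_ (δ-periodic n′ i) (extend-periodic g i)) half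
      where
      coefficient : ∀ {k} → 0 < k → k < n′ → perturbation k ≡ coeff g k
      coefficient 0<k k<n = cong₂ _+_ (δ-positive 0<k k<n) (extend-< g k<n)

      mirror : ∀ {i j} → suc (i ℕ.+ j) ≡ n′ → j ≡ n′ ∸ 1 ∸ i
      mirror {i} {j} i+j = sym (trans (cong (λ k → k ∸ 1 ∸ i) (sym i+j)) (ℕₚ.m+n∸m≡n i j))

      mirror-< : ∀ {i j} → suc (i ℕ.+ j) ≡ n′ → j < n′
      mirror-< {i} {j} i+j = subst (j <_) i+j (s≤s (ℕₚ.m≤n+m j i))

      mirror-positive : ∀ {i j} → suc (i ℕ.+ j) ≡ n′ → i < m → 0 < j
      mirror-positive {i} {zero}  i+j i<m = contradiction
        (subst (ℕ._≤ m) (trans (cong suc (sym (ℕₚ.+-identityʳ i))) i+j) i<m) (ℕₚ.<⇒≱ m<n)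
      mirror-positive {i} {suc j} _   _   = z<s

      half : ∀ i j → suc (i ℕ.+ j) ≡ n′ → i < m → perturbation i ≡ perturbation j
      half zero j i+j i<m = begin
        perturbation 0     ≡⟨ perturbation-0 ⟩
        0#                 ≡⟨ last ⟨
        coeff g (n′ ∸ 1)   ≡⟨ cong (coeff g) (mirror {0} i+j) ⟨
        coeff g j          ≡⟨ coefficient (mirror-positive {0} i+j i<m) (mirror-< {0} i+j) ⟨
        perturbation j     ∎
      half i@(suc _) j i+j i<m with i ≟ 2
      ... | yes refl = begin
        perturbation 2     ≡⟨ perturbation-2 ⟩
        0#                 ≡⟨ third-last ⟨
        coeff g (n′ ∸ 3)   ≡⟨ cong (coeff g) (trans (mirror {2} i+j) (ℕₚ.∸-+-assoc n′ 1 2)) ⟨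
        coeff g j          ≡⟨ coefficient (mirror-positive {2} i+j i<m) (mirror-< {2} i+j) ⟨
        perturbation j     ∎
      ... | no i≢2 = begin
        perturbation i           ≡⟨ coefficient z<s (ℕₚ.<-trans i<m m<n) ⟩
        coeff g i                ≡⟨ symmetric i (s≤s z≤n)
                                      (subst (λ k → i ≤ k ∸ 1) (sym (half-+ m)) (ℕₚ.∸-monoˡ-≤ 1 i<m)) i≢2 ⟩
        coeff g (n′ ∸ 1 ∸ i)     ≡⟨ cong (coeff g) (mirror {i} i+j) ⟨
        coeff g j                ≡⟨ coefficient (mirror-positive {i} i+j i<m) (mirror-< {i} i+j) ⟨
        perturbation j           ∎

    extend-perturbation : ∀ i → extend g i ≡ (δ+ perturbation) i
    extend-perturbation i = solve 2 (λ x y → y := x :+ (x :+ y)) refl (δ n′ i) (extend g i)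

    coeff-·⋆-perturbation : ∀ k → k < n′ → coeff (g · g ⋆) k ≡ A (δ+ perturbation) k
    coeff-·⋆-perturbation k k<n = trans (coeff-·⋆ g k<n) (autocorrelation-cong n′ extend-perturbation k)

  G-factorization-unique : ∀ g g′ → g ∈ G → g′ ∈ G → g · g ⋆ ≡ g′ · g′ ⋆ → g ≡ g′
  G-factorization-unique g g′ g∈G g′∈G eq = coeff-injective λ k k<n → begin
    coeff g k          ≡⟨ extend-< g k<n ⟨
    extend g k         ≡⟨ extend-perturbation g g∈G k ⟩
    δ n′ k + p k       ≡⟨ cong (δ n′ k +_) (p≡p′ k) ⟩
    δ n′ k + p′ k      ≡⟨ extend-perturbation g′ g′∈G k ⟨
    extend g′ k        ≡⟨ extend-< g′ k<n ⟩
    coeff g′ k         ∎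
    where
    p p′ : ℕ → 𝔽₂
    p = perturbation g g∈G
    p′ = perturbation g′ g′∈G
    p≡p′ : ∀ i → p i ≡ p′ i
    p≡p′ = symmetric-determined (perturbation-symmetric g g∈G) (perturbation-symmetric g′ g′∈G)
      (trans (perturbation-0 g g∈G) (sym (perturbation-0 g′ g′∈G)))
      (trans (perturbation-2 g g∈G) (sym (perturbation-2 g′ g′∈G)))
      λ k k<n → trans (sym (coeff-·⋆-perturbation g g∈G k k<n))
                  (trans (cong (λ h → coeff h k) eq) (coeff-·⋆-perturbation g′ g′∈G k k<n))

  -- Existence of the factorization by counting

  unfold : R m → ℕ → 𝔽₂
  -- `coeff v` vanishes from m on, and one of the two mirrored indices always lies there, so at most
  -- one summand is nonzero.
  unfold v i = coeff v (i % n′) + coeff v (n′ ∸ 1 ∸ i % n′)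

  unfold-symmetric : ∀ v → Symmetric n′ (unfold v)
  unfold-symmetric v i j n∣ = trans
    (cong₂ (λ x y → coeff v x + coeff v y)
      (sym (mirror j i (trans (cong suc (ℕₚ.+-comm (j % n′) (i % n′))) i+j))) (mirror i j i+j))
    (+-comm (coeff v (n′ ∸ 1 ∸ j % n′)) (coeff v (j % n′)))
    where
    i+j : suc (i % n′ ℕ.+ j % n′) ≡ n′
    i+j = residue-complement n′ i j n∣
    mirror : ∀ i j → suc (i % n′ ℕ.+ j % n′) ≡ n′ → n′ ∸ 1 ∸ i % n′ ≡ j % n′
    mirror i j i+j = trans (cong (λ k → k ∸ 1 ∸ i % n′) (sym i+j)) (ℕₚ.m+n∸m≡n (i % n′) (j % n′))

  unfold-< : ∀ v {k} → k < m → unfold v k ≡ coeff v k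
  unfold-< v {k} k<m = begin
    unfold v k                            ≡⟨ cong (λ i → coeff v i + coeff v (n′ ∸ 1 ∸ i)) (m<n⇒m%n≡m (ℕₚ.<-trans k<m m<n)) ⟩
    coeff v k + coeff v (n′ ∸ 1 ∸ k)      ≡⟨ cong (coeff v k +_) (coeff-≥ v m≤) ⟩
    coeff v k + 0#                        ≡⟨ +-identityʳ (coeff v k) ⟩
    coeff v k                             ∎
    where
    m≤ : m ≤ n′ ∸ 1 ∸ k
    m≤ = subst (m ≤_) (sym (ℕₚ.∸-+-assoc n′ 1 k)) (subst (_≤ n′ ∸ suc k) (ℕₚ.m+n∸m≡n m m) (ℕₚ.∸-monoʳ-≤ n′ k<m))

  -- The values A(0) and A(1) are determined by the others, so slots 0 and 1 are free to record p₀
  -- and p₂. This gives as many equations as unknowns.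
  equations : R m → ℕ → 𝔽₂
  equations v 0               = unfold v 0
  equations v 1               = unfold v 2
  equations v k@(suc (suc _)) = A (δ+ unfold v) k

  equations-≥2 : ∀ v {k} → 2 ≤ k → equations v k ≡ A (δ+ unfold v) k
  equations-≥2 v (s≤s (s≤s _)) = refl

  -- Both autocorrelations satisfy `IsH`, so agreement at 2, ..., m-1 spreads to all indices;
  -- together with p₀ and p₂ this determines the symmetric sequence.
  equations-injective : ∀ {v w} → (∀ k → k < m → equations v k ≡ equations w k) → v ≡ w
  equations-injective {v} {w} eq = coeff-injective λ k k<m → trans (sym (unfold-< v k<m))
    (trans (symmetric-determined (unfold-symmetric v) (unfold-symmetric w) (eq 0 0<m) (eq 1 1<m)
             (IsH-determined q
               (autocorrelation-δ+-IsH q (unfold-symmetric v)) (autocorrelation-δ+-IsH q (unfold-symmetric w))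
               λ k 2≤k k<m → trans (sym (equations-≥2 v 2≤k)) (trans (eq k k<m) (equations-≥2 w 2≤k))) k)
           (unfold-< w k<m))

  -- The first m equations form a self-map `T` of the finite set `R m`, so injectivity suffices.
  equations-surjective : ∀ s → ∃ λ v → ∀ k → k < m → equations v k ≡ s k
  equations-surjective s = map₂ solution (vec-injective⇒surjective T T-injective (tabulate (s ∘ toℕ)))
    where
    T : R m → R m
    T v = tabulate (equations v ∘ toℕ)
    T-injective : ∀ {v w} → T v ≡ T w → v ≡ w
    T-injective {v} {w} eq = equations-injective λ k k<m → trans (sym (coeff-tabulate (equations v) k<m))
      (trans (cong (λ t → coeff t k) eq) (coeff-tabulate (equations w) k<m))
    solution : ∀ {v} → T v ≡ tabulate (s ∘ toℕ) → ∀ k → k < m → equations v k ≡ s k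
    solution {v} eq k k<m = trans (sym (coeff-tabulate (equations v) k<m))
      (trans (cong (λ t → coeff t k) eq) (coeff-tabulate s k<m))

  symmetric⇒G : ∀ {p} → Symmetric n′ p → p 0 ≡ 0# → p 2 ≡ 0# → tabulate ((δ+ p) ∘ toℕ) ∈ G {n′}
  symmetric⇒G {p} sm p[0] p[2] = record
    { constant   = trans (coeff-tabulate (δ+ p) 0<n) (cong₂ _+_ (δ-zero n′) p[0])
    ; last       = trans (coefficient (ℕₚ.m<n⇒0<n∸m 1<n) (ℕₚ.∸-monoʳ-< z<s (ℕₚ.<⇒≤ 1<n)))
                     (trans (sm (n′ ∸ 1) 0 (∣-reflexive (sym (trans (cong suc (ℕₚ.+-identityʳ _)) (ℕₚ.m+[n∸m]≡n 0<n))))) p[0])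
    ; second     = trans (coefficient z<s 2<n) p[2]
    ; third-last = trans (coefficient (ℕₚ.m<n⇒0<n∸m 3<n) (ℕₚ.∸-monoʳ-< z<s (ℕₚ.<⇒≤ 3<n)))
                     (trans (sm (n′ ∸ 3) 2 (∣-reflexive (sym (trans (cong suc (ℕₚ.+-comm (n′ ∸ 3) 2)) (ℕₚ.m+[n∸m]≡n 2<n))))) p[2])
    ; symmetric  = λ i 1≤i i≤ _ →
        let i<m = pred-half-< q 1≤i i≤
            i<n = ℕₚ.<-trans i<m m<n
            i+1<n = ℕₚ.≤-<-trans i<m m<n
            ∸-assoc = ℕₚ.∸-+-assoc n′ 1 i
        in trans (coefficient 1≤i i<n) (trans
             (sm i (n′ ∸ 1 ∸ i) (∣-reflexive (sym (trans (cong (suc i ℕ.+_) ∸-assoc) (ℕₚ.m+[n∸m]≡n i<n)))))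
             (sym (coefficient (subst (0 <_) (sym ∸-assoc) (ℕₚ.m<n⇒0<n∸m i+1<n))
                    (subst (_< n′) (sym ∸-assoc) (ℕₚ.∸-monoʳ-< z<s i<n)))))
    }
    where
    1<n : 1 < n′
    1<n = ℕₚ.<-trans 1<m m<n
    coefficient : ∀ {k} → 0 < k → k < n′ → coeff (tabulate {n = n′} ((δ+ p) ∘ toℕ)) k ≡ p k
    coefficient 0<k k<n = trans (coeff-tabulate (δ+ p) k<n) (cong (_+ p _) (δ-positive 0<k k<n))

  -- Both `h` and the autocorrelation of δ + p satisfy `IsH`, so the equations at 2, ..., m-1
  -- already force equality everywhere.
  solution⇒factorization : ∀ {h : R n′} → h ∈ H → ∀ v → unfold v 0 ≡ 0# → unfold v 2 ≡ 0# →
    (∀ k → 2 ≤ k → k < m → A (δ+ unfold v) k ≡ coeff h k) → ∃ λ g → g ∈ G × h ≡ g · g ⋆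
  solution⇒factorization {h} h∈H v p[0] p[2] eq = ĝ , symmetric⇒G sm p[0] p[2] , coeff-injective λ k k<n → begin
    coeff h k           ≡⟨ IsH-determined q (H⇒IsH q h∈H) (autocorrelation-δ+-IsH q sm)
                             (λ k 2≤k k<m → sym (eq k 2≤k k<m)) k k<n ⟩
    A (δ+ p) k          ≡⟨ autocorrelation-cong n′ extend-ĝ k ⟨
    A (extend ĝ) k      ≡⟨ coeff-·⋆ ĝ k<n ⟨
    coeff (ĝ · ĝ ⋆) k   ∎
    where
    p : ℕ → 𝔽₂
    p = unfold v
    sm : Symmetric n′ p
    sm = unfold-symmetric v
    ĝ : R n′
    ĝ = tabulate ((δ+ p) ∘ toℕ)
    extend-ĝ : ∀ i → extend ĝ i ≡ (δ+ p) i
    extend-ĝ i = trans (coeff-tabulate (δ+ p) (m%n<n i n′))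
      (periodic-% {f = δ+ p} (λ i → cong₂ _+_ (δ-periodic n′ i) (symmetric⇒periodic sm i)) i)

  G-factorization-exists : ∀ {h : R n′} → h ∈ H → ∃ λ g → g ∈ G × h ≡ g · g ⋆
  G-factorization-exists {h} h∈H = factor (equations-surjective target)
    where
    target : ℕ → 𝔽₂
    -- The first two targets impose p₀ = p₂ = 0, which places 1 + p in `G`.
    target 0               = 0#
    target 1               = 0#
    target k@(suc (suc _)) = coeff h k
    factor : (∃ λ v → ∀ k → k < m → equations v k ≡ target k) → ∃ λ g → g ∈ G × h ≡ g · g ⋆
    factor (v , eq) = solution⇒factorization h∈H v (eq 0 0<m) (eq 1 1<m)
      λ { 1 (s≤s ()) ; k@(suc (suc _)) 2≤k k<m → eq k k<m }

  ·⋆∈H : ∀ {h : R n′} → coeff h 0 ≡ 1# → ∃ (λ g → h ≡ g · g ⋆) → h ∈ H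
  ·⋆∈H h[0] (g , refl) = IsH⇒H q
    (autocorrelation-IsH q (extend-periodic g) (trans (sym (coeff-·⋆ g 0<n)) h[0]))
    (λ k k<n → coeff-·⋆ g k<n)

theorem3p2 : (s n : ℕ) → 2 ≤ s → n ≡ 2 ^ s →
    ((h : R n) → coeff h 0 ≡ 1# → (∃ λ (g : R n) → h ≡ g · g ⋆) ⇔ h ∈ H)
    × ((h : R n) → h ∈ H → ∃! _≡_ λ (g : R n) → g ∈ G × h ≡ g · g ⋆)
theorem3p2 (suc (suc u)) n (s≤s (s≤s _)) n≡2^s with trans n≡2^s (lemma (2 ^ u))
  where
  lemma : ∀ q → 2 ℕ.* (2 ℕ.* q) ≡ (q ℕ.+ q) ℕ.+ (q ℕ.+ q)
  lemma = solve-∀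
-- From here on `n` has the form (q + q) + (q + q) with q = 2 ^ u.
... | refl =
    (λ h h[0] → mk⇔ (·⋆∈H u h[0]) (λ h∈H → let g , _ , h≡ = G-factorization-exists u h∈H in g , h≡))
  , λ h h∈H → let g , g∈G , h≡ = G-factorization-exists u h∈H in
      g , (g∈G , h≡) , λ { (g′∈G , h≡′) → G-factorization-unique u g _ g∈G g′∈G (trans (sym h≡) h≡′) }
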